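{- Let $1<k\in\mathbb{Z}$ and $n=2k+1$. The lexical coloring yields a 1-factorization of $M_k/\pi$ by the colors $0,1,\ldots,k$, which can be lifted to a covering 1-factorization of $M_k$ and subsequently collapsed onto a folding 1-factorization of $R_k$. This ensures the notation $\delta(v)$ for each vertex $v$ of $R_k$, so that there is a unique $k$-germ $\alpha=\alpha(v)$ with $\langle F(\alpha)\rangle=\delta(v)$.
   Context: Graphs. $M_k$ is the graph whose vertices are the binary $n$-strings (coordinates indexed by $\mathbb{Z}_n$) of weight $k$ (set $L_k$) or $k+1$ (set $L_{k+1}$), two being adjacent iff they differ in exactly one entry. $M_k/\pi$ is its quotient (multi)graph under cyclic translation of coordinates: vertices and edges are translation classes of vertices and edges of $M_k$; $L_k/\pi$, $L_{k+1}/\pi$ are the two vertex parts. The complemented reversal $\aleph(b_0\cdots b_{2k})=\bar b_{2k}\cdots\bar b_0$ induces an involution $\aleph_\pi$ of $M_k/\pi$. An edge of $M_k/\pi$ is horizontal if it joins some $v$ to $\aleph_\pi(v)$, and skew otherwise. $R_k$ is the graph with loops whose vertices are the pairs $\{v,\aleph_\pi(v)\}$, $v\in L_k/\pi$, with one edge for each pair of skew edges of $M_k/\pi$ exchanged by $\aleph_\pi$ and one loop for each horizontal edge of $M_k/\pi$. A 1-factorization by colors $0,\ldots,k$ is a coloring of the edges (and loops) such that each vertex is incident to exactly one edge (or loop, a loop counting once) of each color. "Lifted to $M_k$" means each edge of $M_k$ gets the color of its class; "collapsed onto $R_k$" means each edge or loop of $R_k$ gets the common color of the edges of $M_k/\pi$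 it comes from. Lexical coloring. For $b\in L_k$ put $S=\{i:b_i=1\}$, $S^c=\mathbb{Z}_n\setminus S$, and $[y,x)=\{y,y+1,\ldots,x-1\}$ (mod $n$). The edge of $M_k$ joining $b$ to the string obtained by changing $b_x=0$ to $1$ ($x\in S^c$) has color $|\{y\in S^c\setminus\{x\}: |[y,x)\cap S|<|[y,x)\cap S^c|\}|$. This is translation invariant, hence defines colors on the edges of $M_k/\pi$. (Equivalently, translate so that $x=0$; trace in the grid $\{0,\ldots,k\}^2$ the lattice path from $(0,0)$ to $(k,k)$ determined by the entries of the string, a unit step $(1,0)$ for each $0$ and $(0,1)$ for each $1$, and count horizontal steps on the appropriate side of the diagonal.) $\delta(v)$. For $v\in L_k/\pi$ (representing the vertex $\{v,\aleph_\pi(v)\}$ of $R_k$), label each $0$-entry of a representative by the color of the edge obtained by changing it to $1$ and each $1$-entry by $*$; $\delta(v)$ is the resulting cyclic $n$-string of labels written starting at the label $0$. $\langle\cdot\rangle$ denotes the class of a string of labels, written starting at the entry $0$. $k$-germs and $F$. A $k$-germ is a $(k-1)$-string $\alpha=a_{k-1}\cdots a_1$ of nonnegative integers with $a_{k-1}\in\{0,1\}$ and $0\le a_{i-1}\le a_i+1$ for $1<i<k$. For $\alpha\ne0^{k-1}$ with rightmost nonzero entry $a_i$, $\beta(\alpha)$ is obtained from $\alpha$ by replacing $a_i$ by $a_i-1$. $F(0^{k-1})=01\cdots k*\cdots*$ ($k$ asterisks); if $\alpha\ne 0^{k-1}$ has rightmost nonzero entry $a_i$, write $F(\beta(\alpha))=W|X|Y|Z$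 with $W,Z$ its initial and terminal substrings of length $i$, $\Omega$ the first entry of $X$, and $Y$ starting at the entry $\Omega+1$; then $F(\alpha)=W|Y|X|Z$. -}

module Defs where

open import Data.Bool.Base using (not; if_then_else_)
open import Data.Bool.Properties using (not-involutive)
open import Data.Empty using (⊥)
open import Data.Fin.Base using (Fin; zero; suc; toℕ; opposite; fromℕ; inject₁)
open import Data.Fin.Properties using (toℕ-injective; toℕ-fromℕ; toℕ-fromℕ<; toℕ<n; opposite-prop; opposite-involutive)
open import Data.Fin.Subset using (Subset; Side; inside; outside; ∁; _∩_; _-_; ∣_∣)
open import Data.Fin.Subset.Properties using (_∈?_; ∣∁p∣≡n∸∣p∣)
open import Data.List.Base as List using (List; []; _∷_; _++_)
open import Data.Nat.Base using (ℕ; zero; suc; _+_; _*_; _∸_; _≤_; s≤s⁻¹)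
open import Data.Nat.DivMod using (_mod_; _%_; m%n<n; m%n%n≡m%n; %-distribˡ-+; m<n⇒m%n≡m; [m+n]%n≡m%n)
import Data.Nat.Properties as ℕ
open import Data.Product.Base using (Σ; ∃; _×_; _,_; proj₁; proj₂)
open import Data.Product using (∃!)
open import Data.Sum.Base using (_⊎_; inj₁; inj₂)
open import Data.Unit.Base using (⊤)
open import Data.Vec.Base using (Vec; []; _∷_; lookup; tabulate; map; reverse; _∷ʳ_; sum)
open import Data.Vec.Properties using (lookup∘tabulate; tabulate∘lookup; tabulate-cong; lookup-map; reverse-∷; reverse-involutive; map-reverse; map-∘; map-cong; map-id)
open import Function.Base using (_∘_)
open import Level using (0ℓ)
open import Relation.Binary.Bundles using (Setoid)
import Relation.Binary.Construct.On as On
open import Relation.Binary.Definitions using (DecidableEquality)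
open import Relation.Binary.PropositionalEquality
  using (_≡_; _≢_; refl; sym; trans; cong; setoid; module ≡-Reasoning)
open import Relation.Nullary.Decidable using (does; yes; no; map′; _×-dec_)
open import Relation.Nullary.Negation using (¬_)
open import Relation.Unary using (Pred; Decidable)

private
  variable
    A : Set
    m : ℕ

------------------------------------------------------------------------
-- Multigraphs, loops allowed

record Multigraph : Set₁ where
  field
    vertices edges : Setoid 0ℓ 0ℓ

  module V = Setoid vertices
  module E = Setoid edges

  field
    end₁ end₂ : E.Carrier → V.Carrier
    -- Edges are undirected: representatives may list the two ends in
    -- either order.
    ends-cong : ∀ {e f} → e E.≈ f →
                (end₁ e V.≈ end₁ f × end₂ e V.≈ end₂ f) ⊎
                (end₁ e V.≈ end₂ f × end₂ e V.≈ end₁ f)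

  Incident : V.Carrier → E.Carrier → Set
  Incident v e = (v V.≈ end₁ e) ⊎ (v V.≈ end₂ e)

record OneFactorization (G : Multigraph) (k : ℕ)
                        (colour : Multigraph.E.Carrier G → ℕ) : Set where
  open Multigraph G
  field
    colour-cong : ∀ {e f} → e E.≈ f → colour e ≡ colour f
    colour-≤    : ∀ e → colour e ≤ k
    exactly-one : ∀ v c → c ≤ k →
                  ∃! E._≈_ (λ e → Incident v e × colour e ≡ c)

------------------------------------------------------------------------
-- Arithmetic of ℤₙ on Fin n

infixl 6 _⊕_ _⊖_

_⊕_ : Fin (suc m) → Fin (suc m) → Fin (suc m)
i ⊕ j = (toℕ i + toℕ j) mod suc _

_⊖_ : Fin (suc m) → Fin (suc m) → Fin (suc m)
_⊖_ {m} i j = (toℕ i + (suc m ∸ toℕ j)) mod suc m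

toℕ-mod : ∀ a → toℕ (a mod suc m) ≡ a % suc m
toℕ-mod {m} a = toℕ-fromℕ< (m%n<n a (suc m))

toℕ-% : (i : Fin (suc m)) → toℕ i % suc m ≡ toℕ i
toℕ-% i = m<n⇒m%n≡m (toℕ<n i)

%-absorbˡ : ∀ a b → (a % suc m + b) % suc m ≡ (a + b) % suc m
%-absorbˡ {m} a b = begin
  (a % suc m + b) % suc m                     ≡⟨ %-distribˡ-+ (a % suc m) b (suc m) ⟩
  (a % suc m % suc m + b % suc m) % suc m     ≡⟨ cong (λ z → (z + b % suc m) % suc m) (m%n%n≡m%n a (suc m)) ⟩
  (a % suc m + b % suc m) % suc m             ≡⟨ %-distribˡ-+ a b (suc m) ⟨
  (a + b) % suc m                             ∎
  where open ≡-Reasoning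

⊕-comm : (i j : Fin (suc m)) → i ⊕ j ≡ j ⊕ i
⊕-comm {m} i j = cong (_mod suc m) (ℕ.+-comm (toℕ i) (toℕ j))

⊕-assoc : (i j l : Fin (suc m)) → (i ⊕ j) ⊕ l ≡ i ⊕ (j ⊕ l)
⊕-assoc {m} i j l = toℕ-injective (begin
  toℕ ((i ⊕ j) ⊕ l)                          ≡⟨ step i j l ⟩
  (toℕ i + toℕ j + toℕ l) % suc m            ≡⟨ cong (_% suc m) (trans (ℕ.+-assoc (toℕ i) _ _) (ℕ.+-comm (toℕ i) _)) ⟩
  (toℕ j + toℕ l + toℕ i) % suc m            ≡⟨ step j l i ⟨
  toℕ ((j ⊕ l) ⊕ i)                          ≡⟨ cong toℕ (⊕-comm (j ⊕ l) i) ⟩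
  toℕ (i ⊕ (j ⊕ l))                          ∎)
  where
  open ≡-Reasoning
  step : (a b c : Fin (suc m)) → toℕ ((a ⊕ b) ⊕ c) ≡ (toℕ a + toℕ b + toℕ c) % suc m
  step a b c = begin
    toℕ ((a ⊕ b) ⊕ c)                        ≡⟨ toℕ-mod (toℕ (a ⊕ b) + toℕ c) ⟩
    (toℕ (a ⊕ b) + toℕ c) % suc m            ≡⟨ cong (λ z → (z + toℕ c) % suc m) (toℕ-mod (toℕ a + toℕ b)) ⟩
    ((toℕ a + toℕ b) % suc m + toℕ c) % suc m ≡⟨ %-absorbˡ (toℕ a + toℕ b) (toℕ c) ⟩
    (toℕ a + toℕ b + toℕ c) % suc m          ∎

⊕-identityʳ : (i : Fin (suc m)) → i ⊕ zero ≡ i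
⊕-identityʳ {m} i = toℕ-injective (begin
  toℕ (i ⊕ zero)      ≡⟨ toℕ-mod (toℕ i + 0) ⟩
  (toℕ i + 0) % suc m ≡⟨ cong (_% suc m) (ℕ.+-identityʳ (toℕ i)) ⟩
  toℕ i % suc m       ≡⟨ toℕ-% i ⟩
  toℕ i               ∎)
  where open ≡-Reasoning

⊕-⊖ : (i j : Fin (suc m)) → (i ⊖ j) ⊕ j ≡ i
⊕-⊖ {m} i j = toℕ-injective (begin
  toℕ ((i ⊖ j) ⊕ j)                                    ≡⟨ toℕ-mod (toℕ (i ⊖ j) + toℕ j) ⟩
  (toℕ (i ⊖ j) + toℕ j) % suc m                        ≡⟨ cong (λ z → (z + toℕ j) % suc m) (toℕ-mod (toℕ i + (suc m ∸ toℕ j))) ⟩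
  ((toℕ i + (suc m ∸ toℕ j)) % suc m + toℕ j) % suc m  ≡⟨ %-absorbˡ (toℕ i + (suc m ∸ toℕ j)) (toℕ j) ⟩
  (toℕ i + (suc m ∸ toℕ j) + toℕ j) % suc m            ≡⟨ cong (_% suc m) (ℕ.+-assoc (toℕ i) _ _) ⟩
  (toℕ i + (suc m ∸ toℕ j + toℕ j)) % suc m            ≡⟨ cong (λ z → (toℕ i + z) % suc m) (ℕ.m∸n+n≡m (ℕ.<⇒≤ (toℕ<n j))) ⟩
  (toℕ i + suc m) % suc m                              ≡⟨ [m+n]%n≡m%n (toℕ i) (suc m) ⟩
  toℕ i % suc m                                        ≡⟨ toℕ-% i ⟩
  toℕ i                                                ∎)
  where open ≡-Reasoning

⊕-cancelʳ : (a i j : Fin (suc m)) → i ⊕ a ≡ j ⊕ a → i ≡ j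
⊕-cancelʳ a i j eq = trans (sym (undo i)) (trans (cong (_⊕ (zero ⊖ a)) eq) (undo j))
  where
  undo : ∀ x → (x ⊕ a) ⊕ (zero ⊖ a) ≡ x
  undo x = trans (⊕-assoc x a _)
             (trans (cong (x ⊕_) (trans (⊕-comm a _) (⊕-⊖ zero a))) (⊕-identityʳ x))

opposite-⊕ : (i : Fin (suc m)) → opposite i ⊕ i ≡ fromℕ m
opposite-⊕ {m} i = toℕ-injective (begin
  toℕ (opposite i ⊕ i)              ≡⟨ toℕ-mod (toℕ (opposite i) + toℕ i) ⟩
  (toℕ (opposite i) + toℕ i) % suc m ≡⟨ cong (λ z → (z + toℕ i) % suc m) (opposite-prop i) ⟩
  (m ∸ toℕ i + toℕ i) % suc m       ≡⟨ cong (_% suc m) (ℕ.m∸n+n≡m (s≤s⁻¹ (toℕ<n i))) ⟩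
  m % suc m                         ≡⟨ m<n⇒m%n≡m (ℕ.n<1+n m) ⟩
  m                                 ≡⟨ toℕ-fromℕ m ⟨
  toℕ (fromℕ m)                     ∎)
  where open ≡-Reasoning

opposite-shift : (i j : Fin (suc m)) → opposite (i ⊕ (zero ⊖ j)) ≡ opposite i ⊕ j
opposite-shift {m} i j = ⊕-cancelʳ (i ⊕ j′) _ _ (begin
  opposite (i ⊕ j′) ⊕ (i ⊕ j′)  ≡⟨ opposite-⊕ (i ⊕ j′) ⟩
  fromℕ m                       ≡⟨ opposite-⊕ i ⟨
  opposite i ⊕ i                ≡⟨ cong (opposite i ⊕_) (⊕-identityʳ i) ⟨
  opposite i ⊕ (i ⊕ zero)       ≡⟨ cong (λ z → opposite i ⊕ (i ⊕ z)) (⊕-⊖ zero j) ⟨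
  opposite i ⊕ (i ⊕ (j′ ⊕ j))   ≡⟨ cong (opposite i ⊕_) (trans (sym (⊕-assoc i j′ j)) (⊕-comm _ j)) ⟩
  opposite i ⊕ (j ⊕ (i ⊕ j′))   ≡⟨ ⊕-assoc (opposite i) j _ ⟨
  (opposite i ⊕ j) ⊕ (i ⊕ j′)   ∎)
  where
  open ≡-Reasoning
  j′ = zero ⊖ j

------------------------------------------------------------------------
-- Binary strings and cyclic translation
--
-- A binary n-string b is a Subset n, namely {i : bᵢ = 1}; its weight is
-- the cardinality of that subset.

translate : Fin (suc m) → Vec A (suc m) → Vec A (suc m)
translate j u = tabulate (λ i → lookup u (i ⊕ j))

infix 4 _~_

_~_ : Vec A (suc m) → Vec A (suc m) → Set
u ~ w = ∃ λ j → translate j u ≡ w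

translate-zero : (u : Vec A (suc m)) → translate zero u ≡ u
translate-zero u =
  trans (tabulate-cong (λ i → cong (lookup u) (⊕-identityʳ i))) (tabulate∘lookup u)

translate-translate : ∀ l j (u : Vec A (suc m)) →
                      translate l (translate j u) ≡ translate (l ⊕ j) u
translate-translate l j u = tabulate-cong (λ i →
  trans (lookup∘tabulate (λ i → lookup u (i ⊕ j)) (i ⊕ l)) (cong (lookup u) (⊕-assoc i l j)))

translate-inverse : ∀ j (u : Vec A (suc m)) {w} →
                    translate j u ≡ w → translate (zero ⊖ j) w ≡ u
translate-inverse j u refl = begin
  translate (zero ⊖ j) (translate j u) ≡⟨ translate-translate (zero ⊖ j) j u ⟩
  translate ((zero ⊖ j) ⊕ j) u         ≡⟨ cong (λ l → translate l u) (⊕-⊖ zero j) ⟩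
  translate zero u                     ≡⟨ translate-zero u ⟩
  u                                    ∎
  where open ≡-Reasoning

translate-compose : ∀ j l (u : Vec A (suc m)) {v w} →
                    translate j u ≡ v → translate l v ≡ w → translate (l ⊕ j) u ≡ w
translate-compose j l u refl refl = sym (translate-translate l j u)

translationSetoid : Set → ℕ → Setoid 0ℓ 0ℓ
translationSetoid A m = record
  { Carrier       = Vec A (suc m)
  ; _≈_           = _~_
  ; isEquivalence = record
    { refl  = λ {u} → zero , translate-zero u
    ; sym   = λ {u} (j , p) → zero ⊖ j , translate-inverse j u p
    ; trans = λ {u} (j , p) (l , q) → l ⊕ j , translate-compose j l u p q
    }
  }

Adjacent : Subset m → Subset m → Set
Adjacent u w = ∃! _≡_ (λ i → lookup u i ≢ lookup w i)

ℵ : Subset m → Subset m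
ℵ b = ∁ (reverse b)

lookup-∷ʳ-last : (xs : Vec A m) (x : A) → lookup (xs ∷ʳ x) (fromℕ m) ≡ x
lookup-∷ʳ-last []       x = refl
lookup-∷ʳ-last (_ ∷ xs) x = lookup-∷ʳ-last xs x

lookup-∷ʳ-init : (xs : Vec A m) (x : A) (i : Fin m) → lookup (xs ∷ʳ x) (inject₁ i) ≡ lookup xs i
lookup-∷ʳ-init (_ ∷ xs) x zero    = refl
lookup-∷ʳ-init (_ ∷ xs) x (suc i) = lookup-∷ʳ-init xs x i

lookup-reverse-opposite : (xs : Vec A m) (i : Fin m) → lookup (reverse xs) (opposite i) ≡ lookup xs i
lookup-reverse-opposite (x ∷ xs) zero rewrite reverse-∷ x xs = lookup-∷ʳ-last (reverse xs) x
lookup-reverse-opposite (x ∷ xs) (suc i) rewrite reverse-∷ x xs =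
  trans (lookup-∷ʳ-init (reverse xs) x (opposite i)) (lookup-reverse-opposite xs i)

∣∷ʳ∣ : (p : Subset m) → ∀ s → ∣ p ∷ʳ s ∣ ≡ ∣ s ∷ p ∣
∣∷ʳ∣ []            s       = refl
∣∷ʳ∣ (outside ∷ p) outside = ∣∷ʳ∣ p outside
∣∷ʳ∣ (outside ∷ p) inside  = ∣∷ʳ∣ p inside
∣∷ʳ∣ (inside ∷ p)  outside = cong suc (∣∷ʳ∣ p outside)
∣∷ʳ∣ (inside ∷ p)  inside  = cong suc (∣∷ʳ∣ p inside)

∣reverse∣ : (p : Subset m) → ∣ reverse p ∣ ≡ ∣ p ∣
∣reverse∣ []      = refl
∣reverse∣ (s ∷ p) rewrite reverse-∷ s p = trans (∣∷ʳ∣ (reverse p) s) (cons s)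
  where
  cons : ∀ s → ∣ s ∷ reverse p ∣ ≡ ∣ s ∷ p ∣
  cons outside = ∣reverse∣ p
  cons inside  = cong suc (∣reverse∣ p)

lookup-ℵ : (b : Subset m) (i : Fin m) → lookup (ℵ b) i ≡ not (lookup b (opposite i))
lookup-ℵ b i = trans (lookup-map i not (reverse b)) (cong not (begin
  lookup (reverse b) i                       ≡⟨ cong (lookup (reverse b)) (opposite-involutive i) ⟨
  lookup (reverse b) (opposite (opposite i)) ≡⟨ lookup-reverse-opposite b (opposite i) ⟩
  lookup b (opposite i)                      ∎))
  where open ≡-Reasoning

∣ℵ∣ : (b : Subset m) → ∣ ℵ b ∣ ≡ m ∸ ∣ b ∣
∣ℵ∣ {m} b = trans (∣∁p∣≡n∸∣p∣ (reverse b)) (cong (m ∸_) (∣reverse∣ b))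

ℵ-involutive : (b : Subset m) → ℵ (ℵ b) ≡ b
ℵ-involutive b = begin
  map not (reverse (map not (reverse b))) ≡⟨ cong (map not) (map-reverse not (reverse b)) ⟨
  map not (map not (reverse (reverse b))) ≡⟨ map-∘ not not _ ⟨
  map (not ∘ not) (reverse (reverse b))   ≡⟨ map-cong not-involutive _ ⟩
  map (λ s → s) (reverse (reverse b))     ≡⟨ map-id _ ⟩
  reverse (reverse b)                     ≡⟨ reverse-involutive b ⟩
  b                                       ∎
  where open ≡-Reasoning

translate-ℵ : ∀ j (u : Subset (suc m)) {w} → translate j u ≡ w → translate (zero ⊖ j) (ℵ u) ≡ ℵ w
translate-ℵ j u refl = trans (tabulate-cong eq) (tabulate∘lookup (ℵ (translate j u)))
  where
  open ≡-Reasoning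
  eq : ∀ i → lookup (ℵ u) (i ⊕ (zero ⊖ j)) ≡ lookup (ℵ (translate j u)) i
  eq i = begin
    lookup (ℵ u) (i ⊕ (zero ⊖ j))             ≡⟨ lookup-ℵ u _ ⟩
    not (lookup u (opposite (i ⊕ (zero ⊖ j)))) ≡⟨ cong (not ∘ lookup u) (opposite-shift i j) ⟩
    not (lookup u (opposite i ⊕ j))           ≡⟨ cong not (lookup∘tabulate (λ i → lookup u (i ⊕ j)) (opposite i)) ⟨
    not (lookup (translate j u) (opposite i)) ≡⟨ lookup-ℵ (translate j u) i ⟨
    lookup (ℵ (translate j u)) i              ∎

Adjacent-ℵ : (u w : Subset m) → Adjacent u w → Adjacent (ℵ w) (ℵ u)
Adjacent-ℵ u w (i , differ , unique) =
  opposite i ,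
  (λ eq → differ (begin
     lookup u i                       ≡⟨ back u i ⟩
     not (lookup (ℵ u) (opposite i))  ≡⟨ cong not eq ⟨
     not (lookup (ℵ w) (opposite i))  ≡⟨ back w i ⟨
     lookup w i                       ∎)) ,
  (λ {j} ne → trans (cong opposite (unique (λ eq → ne (begin
     lookup (ℵ w) j             ≡⟨ lookup-ℵ w j ⟩
     not (lookup w (opposite j)) ≡⟨ cong not eq ⟨
     not (lookup u (opposite j)) ≡⟨ lookup-ℵ u j ⟨
     lookup (ℵ u) j             ∎)))) (opposite-involutive j))
  where
  open ≡-Reasoning
  back : ∀ b i → lookup b i ≡ not (lookup (ℵ b) (opposite i))
  back b i = sym (begin
    not (lookup (ℵ b) (opposite i))              ≡⟨ cong not (lookup-ℵ b (opposite i)) ⟩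
    not (not (lookup b (opposite (opposite i)))) ≡⟨ not-involutive _ ⟩
    lookup b (opposite (opposite i))             ≡⟨ cong (lookup b) (opposite-involutive i) ⟩
    lookup b i                                   ∎)

------------------------------------------------------------------------
-- Lexical colours

comprehension : {P : Pred (Fin m) 0ℓ} → Decidable P → Subset m
comprehension P? = tabulate (does ∘ P?)

-- The cyclic interval {y, y+1, …, x−1}
[_,_⟩ : Fin (suc m) → Fin (suc m) → Subset (suc m)
[ y , x ⟩ = comprehension (λ i → toℕ (i ⊖ y) ℕ.<? toℕ (x ⊖ y))

lexicalColour : Subset (suc m) → Fin (suc m) → ℕ
lexicalColour S x = ∣ comprehension (λ y →
  (y ∈? (∁ S - x)) ×-dec (∣ [ y , x ⟩ ∩ S ∣ ℕ.<? ∣ [ y , x ⟩ ∩ ∁ S ∣)) ∣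

data Label : Set where
  colour : ℕ → Label
  ∗      : Label

_≟_ : DecidableEquality Label
colour a ≟ colour b = map′ (cong colour) (λ { refl → refl }) (a ℕ.≟ b)
colour _ ≟ ∗        = no λ ()
∗        ≟ colour _ = no λ ()
∗        ≟ ∗        = yes refl

-- A cyclic class of label strings is represented by its member written
-- starting at the (first) entry 0.
⟨_⟩ : List Label → List Label
⟨ w ⟩ = let (x , y) = List.break (_≟ colour 0) w in y ++ x

label : Subset (suc m) → Fin (suc m) → Label
label b i = if lookup b i then ∗ else colour (lexicalColour b i)

------------------------------------------------------------------------
-- The graphs M k, M k / π and R k

module _ (k : ℕ) where

  Translation : Setoid 0ℓ 0ℓ
  Translation = translationSetoid Side (2 * k)

  n : ℕ
  n = suc (2 * k)

  n∸k : n ∸ k ≡ suc k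
  n∸k = begin
    suc (k + (k + 0)) ∸ k ≡⟨ cong (λ z → suc (k + z) ∸ k) (ℕ.+-identityʳ k) ⟩
    suc k + k ∸ k         ≡⟨ ℕ.m+n∸n≡m (suc k) k ⟩
    suc k                 ∎
    where open ≡-Reasoning

  n∸1+k : n ∸ suc k ≡ k
  n∸1+k = trans (ℕ.m+n∸m≡n k (k + 0)) (ℕ.+-identityʳ k)

  L : ℕ → Set
  L w = Σ (Subset n) (λ b → ∣ b ∣ ≡ w)

  -- Strings differing in exactly one entry have different weights, so an
  -- edge of M k has exactly one end in each level.
  record Edge : Set where
    constructor edge
    field
      lower    : L k
      upper    : L (suc k)
      adjacent : Adjacent (proj₁ lower) (proj₁ upper)

    lo hi : Subset n
    lo = proj₁ lower
    hi = proj₁ upper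

    position : Fin n
    position = proj₁ adjacent

  open Edge

  MVertex : Set
  MVertex = Σ (Subset n) (λ b → ∣ b ∣ ≡ k ⊎ ∣ b ∣ ≡ suc k)

  lowerEnd upperEnd : Edge → MVertex
  lowerEnd e = lo e , inj₁ (proj₂ (lower e))
  upperEnd e = hi e , inj₂ (proj₂ (upper e))

  M : Multigraph
  M = record
    { vertices  = On.setoid (setoid (Subset n)) (λ (v : MVertex) → proj₁ v)
    ; edges     = record
      { Carrier       = Edge
      ; _≈_           = λ e f → lo e ≡ lo f × hi e ≡ hi f
      ; isEquivalence = record
        { refl  = refl , refl
        ; sym   = λ (p , q) → sym p , sym q
        ; trans = λ (p , q) (p′ , q′) → trans p p′ , trans q q′
        }
      }
    ; end₁      = lowerEnd
    ; end₂      = upperEnd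
    ; ends-cong = inj₁
    }

  infix 4 _~ᴱ_

  _~ᴱ_ : Edge → Edge → Set
  e ~ᴱ f = ∃ λ j → translate j (lo e) ≡ lo f × translate j (hi e) ≡ hi f

  translationClasses : Setoid 0ℓ 0ℓ
  translationClasses = record
    { Carrier       = Edge
    ; _≈_           = _~ᴱ_
    ; isEquivalence = record
      { refl  = λ {e} → zero , translate-zero (lo e) , translate-zero (hi e)
      ; sym   = λ {e} (j , p , q) →
                  zero ⊖ j , translate-inverse j (lo e) p , translate-inverse j (hi e) q
      ; trans = λ {e} (j , p , q) (l , p′ , q′) →
                  l ⊕ j , translate-compose j l (lo e) p p′ , translate-compose j l (hi e) q q′
      }
    }

  M/π : Multigraph
  M/π = record
    { vertices  = On.setoid Translation (λ (v : MVertex) → proj₁ v)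
    ; edges     = translationClasses
    ; end₁      = lowerEnd
    ; end₂      = upperEnd
    ; ends-cong = λ (j , p , q) → inj₁ ((j , p) , (j , q))
    }

  ℵ-lower : L k → L (suc k)
  ℵ-lower (b , p) = ℵ b , trans (∣ℵ∣ b) (trans (cong (n ∸_) p) n∸k)

  ℵ-upper : L (suc k) → L k
  ℵ-upper (b , p) = ℵ b , trans (∣ℵ∣ b) (trans (cong (n ∸_) p) n∸1+k)

  ℵᴱ : Edge → Edge
  ℵᴱ e = edge (ℵ-upper (upper e)) (ℵ-lower (lower e)) (Adjacent-ℵ (lo e) (hi e) (adjacent e))

  Horizontal Skew : Edge → Set
  Horizontal e = ℵ (lo e) ~ hi e
  Skew e = ¬ Horizontal e

  data REdge : Set where
    link : (e : Edge) → Skew e → REdge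
    loop : (e : Edge) → Horizontal e → REdge

  infix 4 _≈ᴿ_

  _≈ᴿ_ : REdge → REdge → Set
  link e _ ≈ᴿ link f _ = e ~ᴱ f ⊎ e ~ᴱ ℵᴱ f
  loop e _ ≈ᴿ loop f _ = e ~ᴱ f
  link _ _ ≈ᴿ loop _ _ = ⊥
  loop _ _ ≈ᴿ link _ _ = ⊥

  source : REdge → Edge
  source (link e _) = e
  source (loop e _) = e

  module C = Setoid translationClasses

  ℵᴱ-cong : ∀ {e f} → e ~ᴱ f → ℵᴱ e ~ᴱ ℵᴱ f
  ℵᴱ-cong {e} (j , p , q) = zero ⊖ j , translate-ℵ j (hi e) q , translate-ℵ j (lo e) p

  ℵᴱ-involutive : ∀ e → ℵᴱ (ℵᴱ e) ~ᴱ e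
  ℵᴱ-involutive e = zero , trans (translate-zero (ℵ (ℵ (lo e)))) (ℵ-involutive (lo e))
                         , trans (translate-zero (ℵ (ℵ (hi e)))) (ℵ-involutive (hi e))

  ℵᴱ-swap : ∀ {e f} → e ~ᴱ ℵᴱ f → ℵᴱ e ~ᴱ f
  ℵᴱ-swap {e} {f} p = C.trans {ℵᴱ e} {ℵᴱ (ℵᴱ f)} {f} (ℵᴱ-cong {e} {ℵᴱ f} p) (ℵᴱ-involutive f)

  ≈ᴿ-refl : ∀ {e} → e ≈ᴿ e
  ≈ᴿ-refl {link e _} = inj₁ (C.refl {e})
  ≈ᴿ-refl {loop e _} = C.refl {e}

  ≈ᴿ-sym : ∀ {e f} → e ≈ᴿ f → f ≈ᴿ e
  ≈ᴿ-sym {link e _} {link f _} (inj₁ p) = inj₁ (C.sym {e} {f} p)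
  ≈ᴿ-sym {link e _} {link f _} (inj₂ p) = inj₂ (C.sym {ℵᴱ e} {f} (ℵᴱ-swap {e} {f} p))
  ≈ᴿ-sym {loop e _} {loop f _} p        = C.sym {e} {f} p

  ≈ᴿ-trans : ∀ {e f g} → e ≈ᴿ f → f ≈ᴿ g → e ≈ᴿ g
  ≈ᴿ-trans {link e _} {link f _} {link g _} (inj₁ p) (inj₁ q) = inj₁ (C.trans {e} {f} {g} p q)
  ≈ᴿ-trans {link e _} {link f _} {link g _} (inj₁ p) (inj₂ q) = inj₂ (C.trans {e} {f} {ℵᴱ g} p q)
  ≈ᴿ-trans {link e _} {link f _} {link g _} (inj₂ p) (inj₁ q) =
    inj₂ (C.trans {e} {ℵᴱ f} {ℵᴱ g} p (ℵᴱ-cong {f} {g} q))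
  ≈ᴿ-trans {link e _} {link f _} {link g _} (inj₂ p) (inj₂ q) =
    inj₁ (C.trans {e} {ℵᴱ f} {g} p (ℵᴱ-swap {f} {g} q))
  ≈ᴿ-trans {loop e _} {loop f _} {loop g _} p q = C.trans {e} {f} {g} p q

  R-end₁ R-end₂ : REdge → L k
  R-end₁ e = lower (source e)
  R-end₂ e = ℵ-upper (upper (source e))

  R-ends-cong : ∀ {e f} → e ≈ᴿ f →
    (proj₁ (R-end₁ e) ~ proj₁ (R-end₁ f) × proj₁ (R-end₂ e) ~ proj₁ (R-end₂ f)) ⊎
    (proj₁ (R-end₁ e) ~ proj₁ (R-end₂ f) × proj₁ (R-end₂ e) ~ proj₁ (R-end₁ f))
  R-ends-cong {link e _} {link f _} (inj₁ (j , p , q)) = inj₁ ((j , p) , (zero ⊖ j , translate-ℵ j (hi e) q))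
  R-ends-cong {link e _} {link f _} (inj₂ (j , p , q)) =
    inj₂ ((j , p) , (zero ⊖ j , trans (translate-ℵ j (hi e) q) (ℵ-involutive (lo f))))
  R-ends-cong {loop e _} {loop f _} (j , p , q) = inj₁ ((j , p) , (zero ⊖ j , translate-ℵ j (hi e) q))

  -- The vertex {v, ℵ v} is represented by its only member v in L k; hence
  -- an end w in L (k + 1) of an edge of M/π becomes ℵ w.
  R : Multigraph
  R = record
    { vertices  = On.setoid Translation (λ (v : L k) → proj₁ v)
    ; edges     = record
      { Carrier       = REdge
      ; _≈_           = _≈ᴿ_
      ; isEquivalence = record
        { refl  = λ {e} → ≈ᴿ-refl {e}
        ; sym   = λ {e} {f} → ≈ᴿ-sym {e} {f}
        ; trans = λ {e} {f} {g} → ≈ᴿ-trans {e} {f} {g}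
        }
      }
    ; end₁      = R-end₁
    ; end₂      = R-end₂
    ; ends-cong = λ {e} {f} → R-ends-cong {e} {f}
    }

  lexical : Multigraph.E.Carrier M/π → ℕ
  lexical e = lexicalColour (lo e) (position e)

  -- The class of an edge e of M is e itself, taken up to translation.
  lifted : Multigraph.E.Carrier M → ℕ
  lifted e = lexical e

  -- That both edges of a skew pair have the same colour is the field
  -- colour-cong of a 1-factorization of R.
  collapsed : Multigraph.E.Carrier R → ℕ
  collapsed e = lexical (source e)

  δ : Multigraph.V.Carrier R → List Label
  δ (b , _) = ⟨ List.tabulate (label b) ⟩

------------------------------------------------------------------------
-- Germs and the map F
--
-- A string a_{k-1} ⋯ a₁ is stored in reverse, as a₁ ∷ ⋯ ∷ a_{k-1} ∷ [],
-- so its rightmost nonzero entry is the first nonzero one of the vector.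

IsGerm : Vec ℕ m → Set
IsGerm []                = ⊤
IsGerm (a ∷ [])          = a ≡ 0 ⊎ a ≡ 1
IsGerm (a ∷ as@(a′ ∷ _)) = a ≤ suc a′ × IsGerm as

-- The index i of the rightmost nonzero entry aᵢ (not used on 0 ⋯ 0)
rightmost : Vec ℕ m → ℕ
rightmost []          = 1
rightmost (zero ∷ as) = suc (rightmost as)
rightmost (suc _ ∷ _) = 1

β : Vec ℕ m → Vec ℕ m
β []           = []
β (zero ∷ as)  = zero ∷ β as
β (suc a ∷ as) = a ∷ as

-- X|Y ↦ Y|X, where X starts at Ω and Y at Ω + 1
swapBlocks : List Label → List Label
swapBlocks xy@(colour Ω ∷ _) =
  let (x , y) = List.break (_≟ colour (suc Ω)) xy in y ++ x
swapBlocks xy = xy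

-- W|X|Y|Z ↦ W|Y|X|Z, where W and Z have length i
castle : ℕ → List Label → List Label
castle i s = List.take i s ++ swapBlocks (List.drop i (List.take j s)) ++ List.drop j s
  where j = List.length s ∸ i

module _ (k : ℕ) where

  -- β lowers the sum of the entries by one, so that sum serves as the
  -- recursion counter.
  F′ : ℕ → Vec ℕ (k ∸ 1) → List Label
  F′ zero    α = List.map colour (List.upTo (suc k)) ++ List.replicate k ∗
  F′ (suc s) α = castle (rightmost α) (F′ s (β α))

  F : Vec ℕ (k ∸ 1) → List Label
  F α = F′ (sum α) α

{-# OPTIONS --safe #-}
-- Read 0 as a step up and 1 as a step down. The colour at a 0-entry depends
-- only on the string that cyclically follows it, and by the cycle lemma every
-- string of weight k has a rotation 0 E 1 whose inner path E leads from height
-- 0 to height 1 without going below 0. The labels of 0 E 1 are the label 0, the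
-- raised labels of E, and ∗. If E itself starts with label a, it is the
-- rotation to label a of a shorter string 0 E′ 1, and a ≤ a′ + 1 for the first
-- label a′ of E′; so the successive values of a form a germ α. Conversely,
-- castling rotates the block X|Y from its label Ω to its label Ω + 1, so that
-- F(α) is the label string of 0 E 1. In particular each label occurs exactly
-- once among the 0-entries of a string of weight k; strings of weight k + 1
-- are reached through ℵ, which preserves colours because a path crosses a
-- level as often upwards as downwards.
module Submission where

open import Data.Nat.Base using (ℕ; _<_)
open import Data.Product.Base using (_×_; proj₁)
open import Data.Product using (∃!)
open import Relation.Binary.PropositionalEquality using (_≡_)
open import Defs

open import Data.Bool.Base using (Bool; true; false; T; not; if_then_else_; _∧_)
open import Data.Bool.Properties using () renaming (_≟_ to _≟ᵇ_)
open import Data.Fin.Base using (Fin; zero; suc; toℕ; fromℕ; opposite)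
import Data.Fin.Properties as Fin
open import Data.Fin.Subset using (Subset; Side; inside; outside; ∁; _∩_; _-_; ∣_∣; ⁅_⁆)
open import Data.Fin.Subset.Properties using (_∈?_)
open import Data.List.Base as List using (List; []; _∷_; _++_; _∷ʳ_; length; filter; take; drop; break; initLast; _∷ʳ′_)
import Data.List.Properties as List
open import Data.Nat.Base using (zero; suc; _+_; _∸_; _≤_; _<ᵇ_; _≤ᵇ_; z≤n; s≤s; s≤s⁻¹)
open import Data.Nat.DivMod using (_mod_; _%_; m<n⇒m%n≡m; [m+n]%n≡m%n)
import Data.Nat.Properties as ℕ
open import Algebra.Properties.CommutativeSemigroup ℕ.+-commutativeSemigroup using (x∙yz≈y∙xz; x∙yz≈yx∙z)
open import Data.Product.Base using (Σ; ∃; ∃₂; _,_; proj₂; map₁; swap)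
open import Data.Sum.Base using (_⊎_; inj₁; inj₂)
open import Data.Unit.Base using (tt)
open import Data.Vec.Base as Vec using (Vec; []; _∷_; lookup; tabulate; toList; reverse; _[_]≔_)
open import Data.Vec.Properties using (lookup∘tabulate; tabulate∘lookup; tabulate-cong; lookup-map; lookup-zipWith; toList-map; toList-reverse; length-toList; lookup∘update; lookup∘update′; ≡-dec)
open import Function.Base using (_∘_)
open import Relation.Binary.PropositionalEquality using (_≢_; refl; sym; trans; cong; cong₂; subst; subst₂; module ≡-Reasoning)
open import Relation.Nullary.Decidable using (Dec; yes; no; does; dec-true; dec-false)
open import Relation.Nullary.Negation using (contradiction)

private
  variable
    A : Set
    m : ℕ

-- Label strings and germs

-- The recursion `labels` carries both halves of the theorem. Counting: `wrap` shifts the colours up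
-- by one and adds a single 0, and rotation changes no count, so each colour up to the bound occurs
-- once; as every string of weight k is matched with some germ, this count passes to all of them and
-- yields the factorizations. Uniqueness: since a label occurs only once, rotating to it gives the
-- same list for all members of a cyclic class, so a rotation to label a is undone by rotating to 0.
-- Label strings are therefore compared through `⟳` and made canonical only by `rotateTo`. The
-- graphs add one difficulty: two edges of the quotient are equal only if a single translation
-- matches both pairs of ends. Uniqueness of the edge of a given colour is thus proved with the
-- translation given in advance, which serves `M`, `M/π` and `R` alike.

occ : Label → List Label → ℕ
occ ℓ w = length (filter (_≟ ℓ) w)

occ-++ : ∀ ℓ u v → occ ℓ (u ++ v) ≡ occ ℓ u + occ ℓ v
occ-++ ℓ u v = trans (cong length (List.filter-++ (_≟ ℓ) u v)) (List.length-++ (filter (_≟ ℓ) u))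

infix 4 _⟳_

_⟳_ : List A → List A → Set
l ⟳ l′ = ∃₂ λ x y → l ≡ x ++ y × l′ ≡ y ++ x

⟳-sym : {l l′ : List A} → l ⟳ l′ → l′ ⟳ l
⟳-sym (x , y , p , q) = y , x , q , p

⟳-length : {l l′ : List A} → l ⟳ l′ → length l ≡ length l′
⟳-length (x , y , refl , refl) =
  trans (List.length-++ x) (trans (ℕ.+-comm (length x) _) (sym (List.length-++ y)))

⟳-occ : ∀ ℓ {l l′} → l ⟳ l′ → occ ℓ l ≡ occ ℓ l′
⟳-occ ℓ (x , y , refl , refl) =
  trans (occ-++ ℓ x y) (trans (ℕ.+-comm (occ ℓ x) _) (sym (occ-++ ℓ y x)))

rotateTo : Label → List Label → List Label
rotateTo ℓ w = let (x , y) = break (_≟ ℓ) w in y ++ x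

break-++ : ∀ ℓ w → let (x , y) = break (_≟ ℓ) w in x ++ y ≡ w
break-++ ℓ []      = refl
break-++ ℓ (a ∷ w) with does (a ≟ ℓ)
... | true  = refl
... | false = cong (a ∷_) (break-++ ℓ w)

⟳-rotateTo : ∀ ℓ w → w ⟳ rotateTo ℓ w
⟳-rotateTo ℓ w = let (x , y) = break (_≟ ℓ) w in x , y , sym (break-++ ℓ w) , refl

break-fresh : ∀ ℓ x y → occ ℓ x ≡ 0 → break (_≟ ℓ) (x ++ ℓ ∷ y) ≡ (x , ℓ ∷ y)
break-fresh ℓ [] y eq rewrite dec-true (ℓ ≟ ℓ) refl = refl
break-fresh ℓ (a ∷ x) y eq with does (a ≟ ℓ)
... | false = cong (map₁ (a ∷_)) (break-fresh ℓ x y eq)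
... | true  with () ← eq

occ-split : ∀ ℓ w {c} → occ ℓ w ≡ suc c → ∃₂ λ x y → w ≡ x ++ ℓ ∷ y × occ ℓ x ≡ 0
occ-split ℓ (a ∷ w) eq with a ≟ ℓ in q
... | yes refl = [] , w , refl , refl
... | no _ with x , y , refl , fresh ← occ-split ℓ w eq = a ∷ x , y , refl , fresh′
  where
  fresh′ : occ ℓ (a ∷ x) ≡ 0
  fresh′ rewrite q = fresh

rotateTo-here : ∀ ℓ w → rotateTo ℓ (ℓ ∷ w) ≡ ℓ ∷ w
rotateTo-here ℓ w rewrite dec-true (ℓ ≟ ℓ) refl = List.++-identityʳ (ℓ ∷ w)

rotateTo-head : ∀ ℓ w {c} → occ ℓ w ≡ suc c → ∃ λ w′ → rotateTo ℓ w ≡ ℓ ∷ w′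
rotateTo-head ℓ w eq with x , y , refl , fresh ← occ-split ℓ w eq =
  y ++ x , cong (λ (x , y) → y ++ x) (break-fresh ℓ x y fresh)

rotateTo-fresh : ∀ ℓ x y → occ ℓ x ≡ 0 → rotateTo ℓ (x ++ ℓ ∷ y) ≡ ℓ ∷ y ++ x
rotateTo-fresh ℓ x y fresh = cong (λ (x , y) → y ++ x) (break-fresh ℓ x y fresh)

-- The single occurrence of `ℓ` lies in `x` or in `y`, and in either case both sides become `ℓ`
-- followed by the same cyclic continuation. So `rotateTo ℓ` is a normal form for cyclic classes;
-- `⟨_⟩` is its instance at `colour 0`.
rotateTo-⟳ : ∀ ℓ {l l′} → l ⟳ l′ → occ ℓ l ≡ 1 → rotateTo ℓ l ≡ rotateTo ℓ l′
rotateTo-⟳ ℓ (x , y , refl , refl) once with occ ℓ x in ex | trans (sym (occ-++ ℓ x y)) once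
... | zero | ey with a , b , refl , fresh ← occ-split ℓ y ey = begin
  rotateTo ℓ (x ++ a ++ ℓ ∷ b)   ≡⟨ cong (rotateTo ℓ) (List.++-assoc x a (ℓ ∷ b)) ⟨
  rotateTo ℓ ((x ++ a) ++ ℓ ∷ b) ≡⟨ rotateTo-fresh ℓ (x ++ a) b (trans (occ-++ ℓ x a) (cong₂ _+_ ex fresh)) ⟩
  ℓ ∷ b ++ x ++ a                ≡⟨ cong (ℓ ∷_) (List.++-assoc b x a) ⟨
  ℓ ∷ (b ++ x) ++ a              ≡⟨ rotateTo-fresh ℓ a (b ++ x) fresh ⟨
  rotateTo ℓ (a ++ ℓ ∷ b ++ x)   ≡⟨ cong (rotateTo ℓ) (List.++-assoc a (ℓ ∷ b) x) ⟨
  rotateTo ℓ ((a ++ ℓ ∷ b) ++ x) ∎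
  where open ≡-Reasoning
... | suc n | ey with a , b , refl , fresh ← occ-split ℓ x ex = begin
  rotateTo ℓ ((a ++ ℓ ∷ b) ++ y) ≡⟨ cong (rotateTo ℓ) (List.++-assoc a (ℓ ∷ b) y) ⟩
  rotateTo ℓ (a ++ ℓ ∷ b ++ y)   ≡⟨ rotateTo-fresh ℓ a (b ++ y) fresh ⟩
  ℓ ∷ (b ++ y) ++ a              ≡⟨ cong (ℓ ∷_) (List.++-assoc b y a) ⟩
  ℓ ∷ b ++ y ++ a                ≡⟨ rotateTo-fresh ℓ (y ++ a) b fresh′ ⟨
  rotateTo ℓ ((y ++ a) ++ ℓ ∷ b) ≡⟨ cong (rotateTo ℓ) (List.++-assoc y a (ℓ ∷ b)) ⟩
  rotateTo ℓ (y ++ a ++ ℓ ∷ b)   ∎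
  where
  open ≡-Reasoning
  fresh′ : occ ℓ (y ++ a) ≡ 0
  fresh′ = trans (occ-++ ℓ y a) (cong₂ _+_ (ℕ.m+n≡0⇒n≡0 n (ℕ.suc-injective ey)) fresh)

-- Raising labels, and its compatibility with castling

raise : Label → Label
raise (colour c) = colour (suc c)
raise ∗          = ∗

raise-injective : ∀ {a b} → raise a ≡ raise b → a ≡ b
raise-injective {colour _} {colour _} refl = refl
raise-injective {∗}        {∗}        refl = refl

does-raise : ∀ a c → does (raise a ≟ colour (suc c)) ≡ does (a ≟ colour c)
does-raise (colour _) c = refl
does-raise ∗          c = refl

occ-raise : ∀ c w → occ (colour (suc c)) (List.map raise w) ≡ occ (colour c) w
occ-raise c []      = refl
occ-raise c (a ∷ w) rewrite does-raise a c with does (a ≟ colour c)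
... | true  = cong suc (occ-raise c w)
... | false = occ-raise c w

occ-raise-0 : ∀ w → occ (colour 0) (List.map raise w) ≡ 0
occ-raise-0 []             = refl
occ-raise-0 (colour _ ∷ w) = occ-raise-0 w
occ-raise-0 (∗ ∷ w)        = occ-raise-0 w

break-raise : ∀ c w → let (x , y) = break (_≟ colour c) w in
              break (_≟ colour (suc c)) (List.map raise w) ≡ (List.map raise x , List.map raise y)
break-raise c []      = refl
break-raise c (a ∷ w) rewrite does-raise a c with does (a ≟ colour c)
... | true  = refl
... | false = cong (map₁ (raise a ∷_)) (break-raise c w)

rotateTo-raise : ∀ c w → rotateTo (colour (suc c)) (List.map raise w) ≡ List.map raise (rotateTo (colour c) w)
rotateTo-raise c w = let (x , y) = break (_≟ colour c) w in
  trans (cong (λ (x , y) → y ++ x) (break-raise c w)) (sym (List.map-++ raise y x))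

-- Ω and Ω + 1 are raised together, so X and Y are cut at the same places.
swapBlocks-raise : ∀ w → swapBlocks (List.map raise w) ≡ List.map raise (swapBlocks w)
swapBlocks-raise []             = refl
swapBlocks-raise (colour Ω ∷ w) = rotateTo-raise (suc Ω) (colour Ω ∷ w)
swapBlocks-raise (∗ ∷ w)        = refl

castle-raise : ∀ i w → castle i (List.map raise w) ≡ List.map raise (castle i w)
castle-raise i w rewrite List.length-map raise w = sym (begin
  List.map raise (take i w ++ swapBlocks (drop i (take j w)) ++ drop j w)
    ≡⟨ List.map-++ raise (take i w) _ ⟩
  List.map raise (take i w) ++ List.map raise (swapBlocks (drop i (take j w)) ++ drop j w)
    ≡⟨ cong₂ _++_ (sym (List.take-map i w)) (List.map-++ raise (swapBlocks (drop i (take j w))) _) ⟩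
  take i (List.map raise w) ++ List.map raise (swapBlocks (drop i (take j w))) ++ List.map raise (drop j w)
    ≡⟨ cong (take i (List.map raise w) ++_) (cong₂ _++_ mid (sym (List.drop-map j w))) ⟩
  take i (List.map raise w) ++ swapBlocks (drop i (take j (List.map raise w))) ++ drop j (List.map raise w)
    ∎)
  where
  open ≡-Reasoning
  j = length w ∸ i
  mid : List.map raise (swapBlocks (drop i (take j w))) ≡ swapBlocks (drop i (take j (List.map raise w)))
  mid = begin
    List.map raise (swapBlocks (drop i (take j w))) ≡⟨ swapBlocks-raise (drop i (take j w)) ⟨
    swapBlocks (List.map raise (drop i (take j w))) ≡⟨ cong swapBlocks (List.drop-map i _) ⟨
    swapBlocks (drop i (List.map raise (take j w))) ≡⟨ cong (swapBlocks ∘ drop i) (List.take-map j w) ⟨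
    swapBlocks (drop i (take j (List.map raise w))) ∎

take-++ˡ : ∀ i (u v : List A) → i ≤ length u → take i (u ++ v) ≡ take i u
take-++ˡ zero    u       v _       = refl
take-++ˡ (suc i) (a ∷ u) v (s≤s p) = cong (a ∷_) (take-++ˡ i u v p)

drop-++ˡ : ∀ i (u v : List A) → i ≤ length u → drop i (u ++ v) ≡ drop i u ++ v
drop-++ˡ zero    u       v _       = refl
drop-++ˡ (suc i) (a ∷ u) v (s≤s p) = drop-++ˡ i u v p

-- Peeling one letter off each end lowers the index of a castling by one. The descent may reach
-- index 0, where W and Z are empty and `castle` is just `swapBlocks`.
castle-inner : ∀ i a w b → i ≤ length w → castle (suc i) (a ∷ w ++ b ∷ []) ≡ a ∷ castle i w ++ b ∷ []
castle-inner i a w b i≤ rewrite List.length-++ w {b ∷ []} | ℕ.+-comm (length w) 1 | ℕ.+-∸-assoc 1 i≤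
  | take-++ˡ i w (b ∷ []) i≤ | take-++ˡ (length w ∸ i) w (b ∷ []) (ℕ.m∸n≤m (length w) i)
  | drop-++ˡ (length w ∸ i) w (b ∷ []) (ℕ.m∸n≤m (length w) i) =
  cong (a ∷_) (sym (trans (List.++-assoc (take i w) _ _)
    (cong (take i w ++_) (List.++-assoc (swapBlocks (drop i (take (length w ∸ i) w))) _ _))))

castle-zero : ∀ w → castle 0 w ≡ swapBlocks w
castle-zero w rewrite List.take-all (length w) w ℕ.≤-refl | List.drop-all (length w) w ℕ.≤-refl = List.++-identityʳ _

-- wrap (labels α) is F α, and labels α is the block X|Y that the castling at
-- index 1 acts on, with labels lowered by 1.
wrap : List Label → List Label
wrap w = colour 0 ∷ List.map raise w ++ ∗ ∷ []

labels : Vec ℕ m → List Label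
labels []      = colour 0 ∷ []
labels (a ∷ α) = rotateTo (colour a) (wrap (labels α))

-- The value 0 on the empty germ turns the condition that the leading entry be 0 or 1 into the same
-- inequality as for all other entries. It is also the only label of `labels []`.
headOr0 : Vec ℕ m → ℕ
headOr0 []      = 0
headOr0 (a ∷ _) = a

germ-uncons : ∀ a (α : Vec ℕ m) → IsGerm (a ∷ α) → a ≤ suc (headOr0 α) × IsGerm α
germ-uncons a []      (inj₁ refl) = z≤n , tt
germ-uncons a []      (inj₂ refl) = ℕ.≤-refl , tt
germ-uncons a (_ ∷ _) g           = g

germ-cons : ∀ a (α : Vec ℕ m) → a ≤ suc (headOr0 α) → IsGerm α → IsGerm (a ∷ α)
germ-cons zero          []      _        _ = inj₁ refl
germ-cons (suc zero)    []      _        _ = inj₂ refl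
germ-cons (suc (suc a)) []      (s≤s ()) _
germ-cons a             (_ ∷ _) p        g = p , g

-- This bound guarantees that the label to which `labels` rotates is present.
headOr0-≤ : (α : Vec ℕ m) → IsGerm α → headOr0 α ≤ m
headOr0-≤ []      _ = z≤n
headOr0-≤ (a ∷ α) g with p , g′ ← germ-uncons a α g = ℕ.≤-trans p (s≤s (headOr0-≤ α g′))

β-germ : (α : Vec ℕ m) → IsGerm α → IsGerm (β α)
β-germ []          g = g
β-germ (zero ∷ α)  g = germ-cons 0 (β α) z≤n (β-germ α (proj₂ (germ-uncons 0 α g)))
β-germ (suc a ∷ α) g with p , g′ ← germ-uncons (suc a) α g = germ-cons a α (ℕ.≤-trans (ℕ.n≤1+n a) p) g′

length-wrap : ∀ w → length (wrap w) ≡ suc (suc (length w))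
length-wrap w = cong suc (trans (List.length-++ (List.map raise w))
  (trans (ℕ.+-comm _ 1) (cong suc (List.length-map raise w))))

length-labels : (α : Vec ℕ m) → m ≤ length (labels α)
length-labels []      = z≤n
length-labels (a ∷ α) = subst (_ ≤_)
  (trans (sym (length-wrap (labels α))) (⟳-length (⟳-rotateTo (colour a) (wrap (labels α)))))
  (ℕ.m≤n⇒m≤1+n (s≤s (length-labels α)))

𝟙 : Bool → ℕ
𝟙 b = if b then 1 else 0

occ-wrap-0 : ∀ w → occ (colour 0) (wrap w) ≡ 1
occ-wrap-0 w = cong suc (trans (occ-++ (colour 0) (List.map raise w) (∗ ∷ []))
  (trans (ℕ.+-identityʳ _) (occ-raise-0 w)))

occ-wrap-suc : ∀ c w → occ (colour (suc c)) (wrap w) ≡ occ (colour c) w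
occ-wrap-suc c w = trans (occ-++ (colour (suc c)) (List.map raise w) (∗ ∷ []))
  (trans (ℕ.+-identityʳ _) (occ-raise c w))

occ-wrap : ∀ w → (∀ c → occ (colour c) w ≡ 𝟙 (c <ᵇ suc m)) →
           ∀ c → occ (colour c) (wrap w) ≡ 𝟙 (c <ᵇ suc (suc m))
occ-wrap w h zero    = occ-wrap-0 w
occ-wrap w h (suc c) = trans (occ-wrap-suc c w) (h c)

-- The indicator says at once that each colour up to `m` occurs once and that no larger one occurs;
-- `unique-label` and `label-≤` each draw on one half.
occ-labels : (α : Vec ℕ m) → ∀ c → occ (colour c) (labels α) ≡ 𝟙 (c <ᵇ suc m)
occ-labels []      zero    = refl
occ-labels []      (suc c) = refl
occ-labels (a ∷ α) c       =
  trans (sym (⟳-occ (colour c) (⟳-rotateTo (colour a) (wrap (labels α))))) (occ-wrap (labels α) (occ-labels α) c)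

T⇒true : ∀ {b} → T b → b ≡ true
T⇒true {true} _ = refl

occ-once : ∀ w c → occ (colour c) w ≡ 𝟙 (c <ᵇ suc m) → c ≤ m → occ (colour c) w ≡ 1
occ-once w c eq c≤m = trans eq (cong 𝟙 (T⇒true (ℕ.<⇒<ᵇ (s≤s c≤m))))

labels-head : (α : Vec ℕ m) → IsGerm α → ∃ λ w → labels α ≡ colour (headOr0 α) ∷ w
labels-head []      _ = [] , refl
labels-head (a ∷ α) g = rotateTo-head (colour a) (wrap (labels α))
  (occ-once (wrap (labels α)) a (occ-wrap (labels α) (occ-labels α) a) (headOr0-≤ (a ∷ α) g))

rightmost-≤ : (α : Vec ℕ m) → rightmost α ≤ suc m
rightmost-≤ []          = ℕ.≤-refl
rightmost-≤ (zero ∷ α)  = s≤s (rightmost-≤ α)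
rightmost-≤ (suc a ∷ α) = s≤s z≤n

rightmost-suc : (α : Vec ℕ m) → ∃ λ i → rightmost α ≡ suc i
rightmost-suc []          = 0 , refl
rightmost-suc (zero ∷ α)  = _ , refl
rightmost-suc (suc a ∷ α) = _ , refl

-- Rotation to 0 leaves a wrapped string alone, so each trailing 0 of the germ contributes one more
-- layer of `wrap`. `castle-inner` strips a layer together with one unit of the index, and the index
-- is down to 0 exactly when the rightmost nonzero entry is reached. There the block starts with the
-- lowered entry a, so Ω = a and `swapBlocks` rotates it to the label a + 1.
castle-step : (α : Vec ℕ m) → IsGerm α → ∀ {s} → Vec.sum α ≡ suc s →
              castle (rightmost α) (wrap (labels (β α))) ≡ wrap (labels α)
castle-inner-step : (α : Vec ℕ m) → IsGerm α → ∀ {s} → Vec.sum α ≡ suc s → ∀ i → rightmost α ≡ suc i →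
                    i ≤ length (labels (β α)) × castle i (labels (β α)) ≡ labels α

castle-step α g eq with i , r ← rightmost-suc α with i≤ , p ← castle-inner-step α g eq i r rewrite r =
  trans (castle-inner i (colour 0) (List.map raise (labels (β α))) ∗ (subst (i ≤_) (sym (List.length-map raise (labels (β α)))) i≤))
        (cong (λ z → colour 0 ∷ z ++ ∗ ∷ []) (trans (castle-raise i (labels (β α))) (cong (List.map raise) p)))

castle-inner-step (zero ∷ α) g eq i refl =
  ℕ.≤-trans (s≤s⁻¹ (rightmost-≤ (zero ∷ α))) (length-labels (zero ∷ β α)) , (begin
  castle i (rotateTo (colour 0) (wrap (labels (β α)))) ≡⟨ cong (castle i) (rotateTo-here (colour 0) _) ⟩
  castle i (wrap (labels (β α)))                       ≡⟨ castle-step α (proj₂ (germ-uncons 0 α g)) eq ⟩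
  wrap (labels α)                                      ≡⟨ rotateTo-here (colour 0) _ ⟨
  rotateTo (colour 0) (wrap (labels α))                ∎)
  where open ≡-Reasoning
castle-inner-step {suc m} (suc a ∷ α) g eq i refl
  with w , h ← labels-head (a ∷ α) (β-germ (suc a ∷ α) g) = z≤n , (begin
  castle 0 (labels (a ∷ α))                       ≡⟨ castle-zero (labels (a ∷ α)) ⟩
  swapBlocks (labels (a ∷ α))                     ≡⟨ cong swapBlocks h ⟩
  rotateTo (colour (suc a)) (colour a ∷ w)        ≡⟨ cong (rotateTo (colour (suc a))) h ⟨
  -- Both lists belong to one cyclic class, in which this label occurs once.
  rotateTo (colour (suc a)) (labels (a ∷ α))      ≡⟨ rotateTo-⟳ (colour (suc a)) (⟳-rotateTo (colour a) l) once ⟨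
  rotateTo (colour (suc a)) l                     ∎)
  where
  open ≡-Reasoning
  l = wrap (labels α)
  once : occ (colour (suc a)) l ≡ 1
  once = occ-once l (suc a) (occ-wrap (labels α) (occ-labels α) (suc a)) (headOr0-≤ (suc a ∷ α) g)

replicate-∷ʳ : ∀ n (a : A) → List.replicate n a ++ a ∷ [] ≡ List.replicate (suc n) a
replicate-∷ʳ zero    a = refl
replicate-∷ʳ (suc n) a = cong (a ∷_) (replicate-∷ʳ n a)

-- For the zero germ every rotation is trivial, so the string is the single label 0 wrapped m + 1
-- times; each wrapping adds one colour and one asterisk.
labels-zero : (α : Vec ℕ m) → Vec.sum α ≡ 0 →
              List.map colour (List.upTo (suc (suc m))) ++ List.replicate (suc m) ∗ ≡ wrap (labels α)
labels-zero []                  _  = refl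
labels-zero {suc m} (zero ∷ α) eq = sym (begin
  wrap (rotateTo (colour 0) (wrap (labels α)))
    ≡⟨ cong wrap (trans (rotateTo-here (colour 0) _) (sym (labels-zero α eq))) ⟩
  wrap (List.map colour (List.upTo (suc (suc m))) ++ List.replicate (suc m) ∗)
    ≡⟨ cong (λ z → colour 0 ∷ z ++ ∗ ∷ []) (List.map-++ raise (List.map colour (List.upTo (suc (suc m)))) _) ⟩
  colour 0 ∷ (List.map raise (List.map colour (List.upTo (suc (suc m)))) ++ List.map raise (List.replicate (suc m) ∗)) ++ ∗ ∷ []
    ≡⟨ cong₂ (λ y z → colour 0 ∷ (y ++ z) ++ ∗ ∷ []) upTo-eq (List.map-replicate raise (suc m) ∗) ⟩
  colour 0 ∷ (List.map colour (List.applyUpTo suc (suc (suc m))) ++ List.replicate (suc m) ∗) ++ ∗ ∷ []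
    ≡⟨ cong (colour 0 ∷_) (trans (List.++-assoc (List.map colour (List.applyUpTo suc (suc (suc m)))) _ _) (cong (List.map colour (List.applyUpTo suc (suc (suc m))) ++_) (replicate-∷ʳ (suc m) ∗))) ⟩
  List.map colour (List.upTo (suc (suc (suc m)))) ++ List.replicate (suc (suc m)) ∗
    ∎)
  where
  open ≡-Reasoning
  upTo-eq : List.map raise (List.map colour (List.upTo (suc (suc m)))) ≡ List.map colour (List.applyUpTo suc (suc (suc m)))
  upTo-eq = trans (sym (List.map-∘ (List.upTo (suc (suc m)))))
    (trans (List.map-∘ (List.upTo (suc (suc m)))) (cong (List.map colour) (List.map-upTo suc (suc (suc m)))))

sum-β : (α : Vec ℕ m) → ∀ {s} → Vec.sum α ≡ suc s → Vec.sum (β α) ≡ s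
sum-β (zero ∷ α)  eq   = sum-β α eq
sum-β (suc a ∷ α) refl = refl

F-labels : (α : Vec ℕ m) → IsGerm α → F (suc m) α ≡ wrap (labels α)
F-labels {m} α g = go (Vec.sum α) α g refl
  where
  go : ∀ s (α : Vec ℕ m) → IsGerm α → Vec.sum α ≡ s → F′ (suc m) s α ≡ wrap (labels α)
  go zero    α g eq = labels-zero α eq
  go (suc s) α g eq = trans (cong (castle (rightmost α)) (go s (β α) (β-germ α g) (sum-β α eq))) (castle-step α g eq)

wrap-injective : ∀ {u v} → wrap u ≡ wrap v → u ≡ v
wrap-injective {u} {v} eq = List.map-injective raise-injective (List.++-cancelʳ _ _ _ (List.∷-injectiveʳ eq))

-- The first label reveals the entry a; rotating to the only 0 then exposes `wrap (labels α)`, and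
-- the rest of the germ follows by induction.
labels-injective : (α α′ : Vec ℕ m) → IsGerm α → IsGerm α′ → labels α ≡ labels α′ → α ≡ α′
labels-injective []      []        _ _  _  = refl
labels-injective (a ∷ α) (a′ ∷ α′) g g′ eq
  with _ , h ← labels-head (a ∷ α) g | _ , h′ ← labels-head (a′ ∷ α′) g′
  with refl ← List.∷-injectiveˡ (trans (sym h) (trans eq h′)) =
  cong (a ∷_) (labels-injective α α′ (proj₂ (germ-uncons a α g)) (proj₂ (germ-uncons a α′ g′))
    (wrap-injective (trans (sym (unrotate α)) (trans (cong (rotateTo (colour 0)) eq) (unrotate α′)))))
  where
  unrotate : (α : Vec ℕ _) → rotateTo (colour 0) (labels (a ∷ α)) ≡ wrap (labels α)
  unrotate α = trans (sym (rotateTo-⟳ (colour 0) (⟳-rotateTo (colour a) (wrap (labels α))) (occ-wrap-0 (labels α))))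
                     (rotateTo-here (colour 0) _)

-- Binary strings as lattice paths

ones zeros : List Side → ℕ
ones []            = 0
ones (outside ∷ w) = ones w
ones (inside ∷ w)  = suc (ones w)
zeros []            = 0
zeros (outside ∷ w) = suc (zeros w)
zeros (inside ∷ w)  = zeros w

ones-++ : ∀ u v → ones (u ++ v) ≡ ones u + ones v
ones-++ []            v = refl
ones-++ (outside ∷ u) v = ones-++ u v
ones-++ (inside ∷ u)  v = cong suc (ones-++ u v)

zeros-++ : ∀ u v → zeros (u ++ v) ≡ zeros u + zeros v
zeros-++ []            v = refl
zeros-++ (outside ∷ u) v = cong suc (zeros-++ u v)
zeros-++ (inside ∷ u)  v = zeros-++ u v

-- The colour of a 0-entry depends only on the string r that cyclically
-- follows it: it is the number of suffixes of r that begin with a 0 and have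
-- more 0s than 1s.
rank : List Side → ℕ
rank []            = 0
rank (outside ∷ r) = 𝟙 (ones r <ᵇ suc (zeros r)) + rank r
rank (inside ∷ r)  = rank r

≤⇒<ᵇ-suc : ∀ {a b} → a ≤ b → (a <ᵇ suc b) ≡ true
≤⇒<ᵇ-suc p = T⇒true (ℕ.<⇒<ᵇ (s≤s p))

≤⇒≯ᵇ : ∀ {a b} → a ≤ b → (b <ᵇ a) ≡ false
≤⇒≯ᵇ z≤n     = refl
≤⇒≯ᵇ (s≤s p) = ≤⇒≯ᵇ p

<ᵇ-+ʳ : ∀ a b c → (a + c <ᵇ b + c) ≡ (a <ᵇ b)
<ᵇ-+ʳ a b c = trans (cong₂ _<ᵇ_ (ℕ.+-comm a c) (ℕ.+-comm b c)) (go c)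
  where
  go : ∀ c → (c + a <ᵇ c + b) ≡ (a <ᵇ b)
  go zero    = refl
  go (suc c) = go c

-- At each 0-entry of `u`, appending `v` adds the same amount to both sides of the comparison.
rank-++-balanced : ∀ u v → zeros v ≡ ones v → rank (u ++ v) ≡ rank u + rank v
rank-++-balanced []            v bal = refl
rank-++-balanced (outside ∷ u) v bal = trans
  (cong₂ _+_ (cong 𝟙 (trans (cong₂ (λ x y → x <ᵇ suc y) (ones-++ u v) (trans (zeros-++ u v) (cong (zeros u +_) bal)))
                            (<ᵇ-+ʳ (ones u) (suc (zeros u)) (ones v))))
             (rank-++-balanced u v bal))
  (sym (ℕ.+-assoc _ (rank u) (rank v)))
rank-++-balanced (inside ∷ u)  v bal = rank-++-balanced u v bal

-- The 0-entries of `u` see one more 1 and one more 0, hence no change; the inserted 0 is itself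
-- counted because `v` has no surplus of 1s. This is the source of `raise`.
rank-insert : ∀ u v → ones v ≤ zeros v → rank (u ++ inside ∷ outside ∷ v) ≡ suc (rank (u ++ v))
rank-insert []            v v≤ = cong (λ b → 𝟙 b + rank v) (≤⇒<ᵇ-suc v≤)
rank-insert (outside ∷ u) v v≤ = trans
  (cong₂ _+_ (cong 𝟙 (cong₂ _<ᵇ_ (shift ones ones-++ refl) (cong suc (shift zeros zeros-++ refl)))) (rank-insert u v v≤))
  (ℕ.+-suc _ _)
  where
  shift : (f : List Side → ℕ) → (∀ u v → f (u ++ v) ≡ f u + f v) →
          f (inside ∷ outside ∷ v) ≡ suc (f v) → f (u ++ inside ∷ outside ∷ v) ≡ suc (f (u ++ v))
  shift f f-++ e = trans (f-++ u _) (trans (cong (f u +_) e) (trans (ℕ.+-suc (f u) (f v)) (cong suc (sym (f-++ u v)))))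
rank-insert (inside ∷ u)  v v≤ = rank-insert u v v≤

rank-suffix : ∀ u v → rank v ≤ rank (u ++ v)
rank-suffix []            v = ℕ.≤-refl
rank-suffix (outside ∷ u) v = ℕ.≤-trans (rank-suffix u v) (ℕ.m≤n+m _ _)
rank-suffix (inside ∷ u)  v = rank-suffix u v

-- Path h w l: reading 0 as a step up and 1 as a step down, w leads from height
-- h to height l without going below 0.
data Path : ℕ → List Side → ℕ → Set where
  []   : ∀ {h} → Path h [] h
  up   : ∀ {h w l} → Path (suc h) w l → Path h (outside ∷ w) l
  down : ∀ {h w l} → Path h w l → Path (suc h) (inside ∷ w) l

path-count : ∀ {h w l} → Path h w l → h + zeros w ≡ l + ones w
path-count []       = refl
path-count (up p)   = trans (ℕ.+-suc _ _) (path-count p)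
path-count (down p) = trans (cong suc (path-count p)) (sym (ℕ.+-suc _ _))

path-++ : ∀ {h u l v k} → Path h u l → Path l v k → Path h (u ++ v) k
path-++ []       q = q
path-++ (up p)   q = up (path-++ p q)
path-++ (down p) q = down (path-++ p q)

path-lift : ∀ {h w l} → Path h w l → Path (suc h) w (suc l)
path-lift []       = []
path-lift (up p)   = up (path-lift p)
path-lift (down p) = down (path-lift p)

path-split : ∀ {h l} u {v} → Path h (u ++ v) l → ∃ λ k → Path h u k × Path k v l
path-split []            p        = _ , [] , p
path-split (outside ∷ u) (up p)   with k , q , r ← path-split u p = k , up q , r
path-split (inside ∷ u)  (down p) with k , q , r ← path-split u p = k , down q , r

path-last : ∀ {h} w s → Path h (w ∷ʳ s) 0 → s ≡ inside × Path h w 1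
path-last []            inside  (down []) = refl , []
path-last []            outside (up ())
path-last (outside ∷ w) s       (up p)    with e , q ← path-last w s p = e , up q
path-last (inside ∷ w)  s       (down p)  with e , q ← path-last w s p = e , down q

-- Every suffix leads from a height at least 0 down to 0, so it has at least as many 1s as 0s and
-- nothing is counted.
rank-descent : ∀ {h w} → Path h w 0 → rank w ≡ 0
rank-descent []       = refl
rank-descent {h} (up {w = w} p) = cong₂ _+_
  (cong 𝟙 (≤⇒≯ᵇ (ℕ.≤-trans (s≤s (ℕ.m≤n+m (zeros w) h)) (ℕ.≤-reflexive (path-count p)))))
  (rank-descent p)
rank-descent (down p) = rank-descent p

-- u ends where the height is minimal for the last time.
lastMinimum : ∀ w → (∃ λ a → Path a w 0) ⊎
  (∃₂ λ u v → ∃₂ λ a b → w ≡ u ++ outside ∷ v × Path a u 0 × Path 0 v b)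
lastMinimum [] = inj₁ (0 , [])
lastMinimum (inside ∷ w) with lastMinimum w
... | inj₁ (a , p)                       = inj₁ (suc a , down p)
... | inj₂ (u , v , a , b , refl , p , q) = inj₂ (inside ∷ u , v , suc a , b , refl , down p , q)
lastMinimum (outside ∷ w) with lastMinimum w
... | inj₁ (suc a , p)                        = inj₁ (a , up p)
... | inj₁ (zero , p)                         = inj₂ ([] , w , 0 , 0 , refl , [] , p)
... | inj₂ (u , v , suc a , b , refl , p , q) = inj₂ (outside ∷ u , v , a , b , refl , up p , q)
... | inj₂ (u , v , zero , b , refl , p , q)  =
  inj₂ ([] , u ++ outside ∷ v , 0 , suc b , refl , [] , path-++ p (up (path-lift q)))

-- A total rise of one prevents the last minimum from lying at the end, so a 0 follows it. Counting
-- then shows that `v` climbs as far as `u` falls; thus `v ++ u` is a path from 0 to 0, and the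
-- rotation sought is 0 followed by `v ++ u`.
cycleLemma : ∀ w → zeros w ≡ suc (ones w) →
  ∃₂ λ u v → ∃ λ a → w ≡ u ++ outside ∷ v × Path a u 0 × Path 0 v a
cycleLemma w bal with lastMinimum w
... | inj₁ (a , p) = contradiction (trans (sym (path-count p)) (cong (a +_) bal))
                                   (ℕ.<⇒≢ (ℕ.m≤n+m (suc (ones w)) a))
... | inj₂ (u , v , a , b , refl , p , q) = u , v , a , refl , p , subst (Path 0 v) b≡a q
  where
  open ≡-Reasoning
  b≡a : b ≡ a
  b≡a = ℕ.+-cancelʳ-≡ (zeros u + ones v) b a (begin
    b + (zeros u + ones v)                 ≡⟨ x∙yz≈y∙xz b (zeros u) (ones v) ⟩
    zeros u + (b + ones v)                 ≡⟨ cong (zeros u +_) (path-count q) ⟨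
    zeros u + zeros v                      ≡⟨ ℕ.suc-injective (trans (sym (ℕ.+-suc (zeros u) _)) (trans (sym (zeros-++ u (outside ∷ v))) bal)) ⟩
    ones (u ++ outside ∷ v)                ≡⟨ ones-++ u (outside ∷ v) ⟩
    ones u + ones v                        ≡⟨ cong (_+ ones v) (path-count p) ⟨
    a + zeros u + ones v                   ≡⟨ ℕ.+-assoc a _ _ ⟩
    a + (zeros u + ones v)                 ∎)

colour-injective : ∀ {a b} → colour a ≡ colour b → a ≡ b
colour-injective refl = refl

-- Label strings of cyclic binary strings

entry : Side → List Side → Label
entry outside r = colour (rank r)
entry inside  r = ∗

-- The labels of the part w of the cyclic string w ++ rest.
labelsIn : List Side → List Side → List Label
labelsIn rest []      = []
labelsIn rest (s ∷ w) = entry s (w ++ rest) ∷ labelsIn (rest ∷ʳ s) w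

labelsIn-++ : ∀ rest u v → labelsIn rest (u ++ v) ≡ labelsIn (v ++ rest) u ++ labelsIn (rest ++ u) v
labelsIn-++ rest []      v = cong (λ r → labelsIn r v) (sym (List.++-identityʳ rest))
labelsIn-++ rest (s ∷ u) v = cong₂ _∷_ (cong (entry s) (List.++-assoc u v rest))
  (trans (labelsIn-++ (rest ∷ʳ s) u v)
         (cong₂ (λ x y → labelsIn x u ++ labelsIn y v) (sym (List.++-assoc v rest _)) (List.++-assoc rest _ u)))

labelsIn-⟳ : ∀ u v → labelsIn [] (u ++ v) ⟳ labelsIn [] (v ++ u)
labelsIn-⟳ u v = labelsIn v u , labelsIn u v ,
  trans (labelsIn-++ [] u v) (cong (λ z → labelsIn z u ++ labelsIn u v) (List.++-identityʳ v)) ,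
  trans (labelsIn-++ [] v u) (cong (λ z → labelsIn z v ++ labelsIn v u) (List.++-identityʳ u))

labelsIn-cong : ∀ {w w′} → w ⟳ w′ → labelsIn [] w ⟳ labelsIn [] w′
labelsIn-cong (u , v , refl , refl) = labelsIn-⟳ u v

-- `p` is the part already traversed, and the equation keeps `h` as its surplus of 0s over 1s. A
-- path that stays at or above 0 thus meets the hypothesis of `rank-insert` at each of its
-- 0-entries.
labelsIn-raise : ∀ {h l} p {w} → zeros p ≡ h + ones p → Path h w l →
                 labelsIn (inside ∷ outside ∷ p) w ≡ List.map raise (labelsIn p w)
labelsIn-raise p e [] = refl
labelsIn-raise {h} p e (up {w = w} q) = cong₂ _∷_
  (cong colour (rank-insert w p (ℕ.≤-trans (ℕ.m≤n+m (ones p) h) (ℕ.≤-reflexive (sym e)))))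
  (labelsIn-raise (p ∷ʳ outside) (trans (zeros-++ p _) (trans (ℕ.+-comm _ 1)
    (cong suc (trans e (cong (h +_) (sym (trans (ones-++ p _) (ℕ.+-identityʳ _)))))))) q)
labelsIn-raise {suc h} p e (down q) = cong (∗ ∷_)
  (labelsIn-raise (p ∷ʳ inside) (trans (zeros-++ p _) (trans (ℕ.+-identityʳ _)
    (trans e (trans (sym (ℕ.+-suc h _)) (cong (h +_) (sym (trans (ones-++ p _) (ℕ.+-comm _ 1)))))))) q)

labelsIn-wrap : ∀ {w} → Path 0 w 1 → labelsIn [] (outside ∷ w ∷ʳ inside) ≡ wrap (labelsIn [] w)
labelsIn-wrap {w} p = cong₂ _∷_
  (cong colour (trans (cong rank (List.++-identityʳ (w ∷ʳ inside))) (rank-descent (path-++ p (down [])))))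
  -- Cyclically, `w` is followed by its closing 1 and then the opening 0: the inserted pair, with
  -- nothing traversed yet.
  (trans (labelsIn-++ (outside ∷ []) w (inside ∷ [])) (cong (_++ ∗ ∷ []) (labelsIn-raise [] refl p)))

unsnoc-dyck : ∀ w → Path 0 w 0 → ones w ≡ suc m → ∃ λ e → w ≡ e ∷ʳ inside × Path 0 e 1 × ones e ≡ m
unsnoc-dyck w p eq with initLast w
... | e ∷ʳ′ s with refl , q ← path-last e s p =
  e , refl , q , ℕ.suc-injective (trans (ℕ.+-comm 1 (ones e)) (trans (sym (ones-++ e (inside ∷ []))) eq))

-- For nonempty u, rank r and suc (rank r′) are the colours of two 0-entries at
-- height 1 of the string outside ∷ v ++ u, the latter of the first such entry;
-- at equal height colours decrease from left to right.
rank-head : ∀ u v {r r′} → Path 0 u 0 → Path 0 v 0 → u ++ outside ∷ v ≡ outside ∷ r →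
            v ++ u ≡ outside ∷ r′ ∷ʳ inside → rank r ≤ suc (rank r′)
rank-head [] v p q refl _ = ℕ.≤-trans (ℕ.≤-reflexive (rank-descent q)) z≤n
rank-head (outside ∷ u) v {r′ = r′} p q refl eq = begin
  rank (u ++ outside ∷ v)              ≡⟨ cong rank (List.++-assoc u (outside ∷ []) v) ⟨
  rank ((u ∷ʳ outside) ++ v)           ≡⟨ rank-++-balanced (u ∷ʳ outside) v (path-count q) ⟩
  rank (u ∷ʳ outside) + rank v         ≡⟨ cong (rank (u ∷ʳ outside) +_) (rank-descent q) ⟩
  rank (u ∷ʳ outside) + 0              ≡⟨ ℕ.+-identityʳ _ ⟩
  rank (u ∷ʳ outside)                  ≤⟨ bound v eq ⟩
  rank ((r′ ∷ʳ inside) ∷ʳ outside)     ≡⟨ cong rank (List.++-assoc r′ (inside ∷ []) _) ⟩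
  rank (r′ ++ inside ∷ outside ∷ [])   ≡⟨ rank-insert r′ [] z≤n ⟩
  suc (rank (r′ ++ []))                ≡⟨ cong (suc ∘ rank) (List.++-identityʳ r′) ⟩
  suc (rank r′)                        ∎
  where
  open ℕ.≤-Reasoning
  -- In either case `u` is a suffix of `r′ ∷ʳ inside`: the whole of it for empty `v`, otherwise what
  -- remains after the tail of `v` and a 0.
  bound : ∀ v → v ++ outside ∷ u ≡ outside ∷ r′ ∷ʳ inside → rank (u ∷ʳ outside) ≤ rank ((r′ ∷ʳ inside) ∷ʳ outside)
  bound []      eq rewrite List.∷-injectiveʳ eq = ℕ.≤-refl
  bound (_ ∷ v) eq rewrite sym (List.∷-injectiveʳ eq) | List.++-assoc v (outside ∷ u) (outside ∷ []) =
    ℕ.≤-trans (rank-suffix (v ∷ʳ outside) (u ∷ʳ outside)) (ℕ.≤-reflexive (cong rank (List.++-assoc v _ _)))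
rank-head (inside ∷ u) v ()

head-0 : ∀ {w} → Path 0 w 1 → ∃ λ r → w ≡ outside ∷ r
head-0 (up {w = r} _) = r , refl

unsnoc-rotation : ∀ u v {a} → Path a u 0 → Path 0 v a → ones (u ++ outside ∷ v) ≡ suc m →
                  ∃ λ e → v ++ u ≡ e ∷ʳ inside × Path 0 e 1 × ones e ≡ m
unsnoc-rotation u v p q eq = unsnoc-dyck (v ++ u) (path-++ q p)
  (trans (ones-++ v u) (trans (ℕ.+-comm (ones v) _) (trans (sym (ones-++ u (outside ∷ v))) eq)))

labelsIn-⟳-wrap : ∀ u v {e l} → v ++ u ≡ e ∷ʳ inside → Path 0 e 1 → labelsIn [] e ≡ l →
                  labelsIn [] (u ++ outside ∷ v) ⟳ wrap l
labelsIn-⟳-wrap u v vu p le = subst (labelsIn [] (u ++ outside ∷ v) ⟳_)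
  (trans (cong (labelsIn [] ∘ (outside ∷_)) vu) (trans (labelsIn-wrap p) (cong wrap le)))
  (labelsIn-⟳ u (outside ∷ v))

-- Since `w` rises by one, the cycle lemma applies to `w` itself and yields a shorter inner path
-- `e`, whose germ is extended by the first label of `w`. The germ inequality for this new entry is
-- `rank-head`.
labels-surjective : ∀ m {w} → Path 0 w 1 → ones w ≡ m →
                    Σ (Vec ℕ m) λ α → IsGerm α × labelsIn [] w ≡ labels α
labels-surjective zero (up []) eq = [] , tt , refl
labels-surjective zero (up (up p)) eq =
  contradiction (trans (sym (ℕ.+-suc 1 _)) (trans (path-count p) (cong suc eq))) λ ()
labels-surjective (suc m) {w} path eq
  with u , v , a , refl , p , q ← cycleLemma w (path-count path)
  with k , p′ , _ ← path-split u path
  -- `u` falls by `a`, yet as a prefix of `w` it leads from 0 to some height `k`; so a + k = 0, and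
  -- both `u` and `v` are paths from 0 to 0.
  with refl ← ℕ.m+n≡0⇒m≡0 a (ℕ.+-cancelʳ-≡ (ones u) (a + k) 0
    (trans (ℕ.+-assoc a k _) (trans (cong (a +_) (sym (path-count p′))) (path-count p))))
  with e , vu , pe , eq′ ← unsnoc-rotation u v p q eq
  with α , germ , le ← labels-surjective m pe eq′
  with r , we ← head-0 path | r′ , refl ← head-0 pe
  = rank r ∷ α , germ′ , (begin
      labelsIn [] (u ++ outside ∷ v)               ≡⟨ cong (labelsIn []) we ⟩
      labelsIn [] (outside ∷ r)                    ≡⟨ first ⟨
      rotateTo ℓ (labelsIn [] (outside ∷ r))       ≡⟨ cong (rotateTo ℓ ∘ labelsIn []) we ⟨
      rotateTo ℓ (labelsIn [] (u ++ outside ∷ v))  ≡⟨ rotateTo-⟳ ℓ (⟳-sym (labelsIn-⟳-wrap u v vu pe le)) once ⟨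
      rotateTo ℓ (wrap (labels α))                 ∎)
  where
  open ≡-Reasoning
  ℓ = colour (rank r)
  first : rotateTo ℓ (labelsIn [] (outside ∷ r)) ≡ labelsIn [] (outside ∷ r)
  first rewrite List.++-identityʳ r = rotateTo-here _ _
  head-α : rank r′ ≡ headOr0 α
  head-α with _ , h ← labels-head α germ =
    trans (cong rank (sym (List.++-identityʳ r′))) (colour-injective (List.∷-injectiveˡ (trans le h)))
  germ′ : IsGerm (rank r ∷ α)
  germ′ = germ-cons (rank r) α (ℕ.≤-trans (rank-head u v p q we vu) (ℕ.≤-reflexive (cong suc head-α))) germ
  once : occ ℓ (wrap (labels α)) ≡ 1
  once = occ-once (wrap (labels α)) (rank r) (occ-wrap (labels α) (occ-labels α) (rank r)) (headOr0-≤ (rank r ∷ α) germ′)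

labelsIn-germ : ∀ w → zeros w ≡ suc (ones w) → ones w ≡ suc m →
                Σ (Vec ℕ m) λ α → IsGerm α × labelsIn [] w ⟳ wrap (labels α)
labelsIn-germ {m} w bal eq
  with u , v , a , refl , p , q ← cycleLemma w bal
  with e , vu , pe , eq′ ← unsnoc-rotation u v p q eq
  with α , germ , le ← labels-surjective m pe eq′
  = α , germ , labelsIn-⟳-wrap u v vu pe le

-- Translation and lexical colours

vec-ext : {u v : Vec A m} → (∀ i → lookup u i ≡ lookup v i) → u ≡ v
vec-ext {u = u} {v} h = trans (sym (tabulate∘lookup u)) (trans (tabulate-cong h) (tabulate∘lookup v))

applyUpTo-+ : ∀ (g : ℕ → A) a b → List.applyUpTo g (a + b) ≡ List.applyUpTo g a ++ List.applyUpTo (g ∘ (a +_)) b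
applyUpTo-+ g zero    b = refl
applyUpTo-+ g (suc a) b = cong (g 0 ∷_) (applyUpTo-+ (g ∘ suc) a b)

applyUpTo-cong : {f g : ℕ → A} → (∀ t → f t ≡ g t) → ∀ a → List.applyUpTo f a ≡ List.applyUpTo g a
applyUpTo-cong h zero    = refl
applyUpTo-cong h (suc a) = cong₂ _∷_ (h 0) (applyUpTo-cong (h ∘ suc) a)

toList-tabulate : ∀ m (g : ℕ → A) → toList (tabulate {n = m} (g ∘ toℕ)) ≡ List.applyUpTo g m
toList-tabulate zero    g = refl
toList-tabulate (suc m) g = cong (g 0 ∷_) (toList-tabulate m (g ∘ suc))

++-injective : (x x′ : List A) {y y′ : List A} → length x ≡ length x′ → x ++ y ≡ x′ ++ y′ → x ≡ x′ × y ≡ y′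
++-injective []      []        _ eq = refl , eq
++-injective (a ∷ x) (a′ ∷ x′) l eq with refl ← List.∷-injectiveˡ eq
  with refl , q ← ++-injective x x′ (ℕ.suc-injective l) (List.∷-injectiveʳ eq) = refl , q

-- Extended periodically to a function `g` on the natural numbers, `u` is translated by shifting the
-- argument, and both cuts are instances of `applyUpTo-+`.
translate-split : ∀ j (u : Vec A (suc m)) → ∃₂ λ x y →
                  length x ≡ toℕ j × toList u ≡ x ++ y × toList (translate j u) ≡ y ++ x
translate-split {m = m} j u = List.applyUpTo g a , List.applyUpTo (g ∘ (a +_)) b , List.length-applyUpTo g a , (begin
  toList u                                                  ≡⟨ cong toList u≡ ⟨
  toList (tabulate {n = suc m} (g ∘ toℕ))                   ≡⟨ toList-tabulate (suc m) g ⟩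
  List.applyUpTo g (suc m)                                  ≡⟨ cong (List.applyUpTo g) (trans (ℕ.+-comm a b) b+a) ⟨
  List.applyUpTo g (a + b)                                  ≡⟨ applyUpTo-+ g a b ⟩
  List.applyUpTo g a ++ List.applyUpTo (g ∘ (a +_)) b       ∎) , (begin
  toList (translate j u)                                    ≡⟨ toList-tabulate (suc m) (λ t → g (t + a)) ⟩
  List.applyUpTo (λ t → g (t + a)) (suc m)                  ≡⟨ cong (List.applyUpTo (λ t → g (t + a))) b+a ⟨
  List.applyUpTo (λ t → g (t + a)) (b + a)                  ≡⟨ applyUpTo-+ (λ t → g (t + a)) b a ⟩
  List.applyUpTo (λ t → g (t + a)) b ++ List.applyUpTo (λ t → g (b + t + a)) a
    ≡⟨ cong₂ _++_ (applyUpTo-cong (λ t → cong g (ℕ.+-comm t a)) b) (applyUpTo-cong periodic a) ⟩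
  List.applyUpTo (g ∘ (a +_)) b ++ List.applyUpTo g a       ∎)
  where
  open ≡-Reasoning
  g : ℕ → _
  g t = lookup u (t mod suc m)
  a = toℕ j
  b = suc m ∸ a
  b+a : b + a ≡ suc m
  b+a = ℕ.m∸n+n≡m (ℕ.<⇒≤ (Fin.toℕ<n j))
  u≡ : tabulate (g ∘ toℕ) ≡ u
  u≡ = trans (tabulate-cong (λ i → cong (lookup u) (Fin.toℕ-injective (trans (toℕ-mod (toℕ i)) (toℕ-% i))))) (tabulate∘lookup u)
  periodic : ∀ t → g (b + t + a) ≡ g t
  periodic t = cong (lookup u) (Fin.toℕ-injective (begin
    toℕ ((b + t + a) mod suc m)  ≡⟨ toℕ-mod (b + t + a) ⟩
    (b + t + a) % suc m          ≡⟨ cong (_% suc m) (trans (cong (_+ a) (ℕ.+-comm b t)) (trans (ℕ.+-assoc t b a) (cong (t +_) b+a))) ⟩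
    (t + suc m) % suc m          ≡⟨ [m+n]%n≡m%n t (suc m) ⟩
    t % suc m                    ≡⟨ toℕ-mod t ⟨
    toℕ (t mod suc m)            ∎))

toList-translate : ∀ j (u : Vec A (suc m)) {x y} → length x ≡ toℕ j → toList u ≡ x ++ y → toList (translate j u) ≡ y ++ x
toList-translate j u {x} l eq with x′ , y′ , l′ , eq′ , t ← translate-split j u
  with refl , refl ← ++-injective x x′ (trans l (sym l′)) (trans (sym eq) eq′) = t

translate-⟳ : ∀ j (u : Vec A (suc m)) → toList u ⟳ toList (translate j u)
translate-⟳ j u with x , y , _ , p , q ← translate-split j u = x , y , p , q

∣∣-ones : (p : Subset m) → ∣ p ∣ ≡ ones (toList p)
∣∣-ones []            = refl
∣∣-ones (outside ∷ p) = ∣∣-ones p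
∣∣-ones (inside ∷ p)  = cong suc (∣∣-ones p)

zeros+ones : ∀ w → zeros w + ones w ≡ length w
zeros+ones []            = refl
zeros+ones (outside ∷ w) = cong suc (zeros+ones w)
zeros+ones (inside ∷ w)  = trans (ℕ.+-suc _ _) (cong suc (zeros+ones w))

ones-not : ∀ w → ones (List.map not w) ≡ zeros w
ones-not []            = refl
ones-not (outside ∷ w) = cong suc (ones-not w)
ones-not (inside ∷ w)  = ones-not w

⟳-ones : ∀ {u v} → u ⟳ v → ones u ≡ ones v
⟳-ones (x , y , refl , refl) = trans (ones-++ x y) (trans (ℕ.+-comm (ones x) _) (sym (ones-++ y x)))

∣translate∣ : ∀ j (p : Subset (suc m)) → ∣ translate j p ∣ ≡ ∣ p ∣
∣translate∣ j p = trans (∣∣-ones (translate j p)) (trans (sym (⟳-ones (translate-⟳ j p))) (sym (∣∣-ones p)))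

lookup-translate : ∀ j (u : Vec A (suc m)) i → lookup (translate j u) i ≡ lookup u (i ⊕ j)
lookup-translate j u i = lookup∘tabulate (λ i → lookup u (i ⊕ j)) i

⊕-identityˡ : (i : Fin (suc m)) → zero ⊕ i ≡ i
⊕-identityˡ i = trans (⊕-comm zero i) (⊕-identityʳ i)

⊖-⊕ : (i y j : Fin (suc m)) → (i ⊕ j) ⊖ (y ⊕ j) ≡ i ⊖ y
⊖-⊕ i y j = ⊕-cancelʳ (y ⊕ j) _ _ (trans (⊕-⊖ (i ⊕ j) (y ⊕ j))
  (trans (cong (_⊕ j) (sym (⊕-⊖ i y))) (⊕-assoc (i ⊖ y) y j)))

does-∈? : (p : Subset m) (y : Fin m) → does (y ∈? p) ≡ lookup p y
does-∈? (inside ∷ p)  zero    = refl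
does-∈? (outside ∷ p) zero    = refl
does-∈? (s ∷ p)       (suc y) = does-∈? p y

lookup-⁅⁆ : (x y : Fin m) → lookup ⁅ x ⁆ y ≡ does (y Fin.≟ x)
lookup-⁅⁆ zero    zero    = refl
lookup-⁅⁆ zero    (suc y) = lookup-⊥ y
  where
  lookup-⊥ : (y : Fin m) → lookup (Data.Fin.Subset.⊥) y ≡ outside
  lookup-⊥ zero    = refl
  lookup-⊥ (suc y) = lookup-⊥ y
lookup-⁅⁆ (suc x) zero    = refl
lookup-⁅⁆ (suc x) (suc y) = lookup-⁅⁆ x y

lookup-- : (p : Subset m) (x y : Fin m) → lookup (p - x) y ≡ (if does (y Fin.≟ x) then outside else lookup p y)
lookup-- p x y with lookup ⁅ x ⁆ y in eq | lookup-zipWith _ y p ⁅ x ⁆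
... | inside  | e rewrite trans (sym (lookup-⁅⁆ x y)) eq = e
... | outside | e rewrite trans (sym (lookup-⁅⁆ x y)) eq = e

does-≟-⊕ : (x y j : Fin (suc m)) → does (y ⊕ j Fin.≟ x ⊕ j) ≡ does (y Fin.≟ x)
does-≟-⊕ x y j with y Fin.≟ x
... | yes refl = dec-true (y ⊕ j Fin.≟ y ⊕ j) refl
... | no y≢x   = dec-false (y ⊕ j Fin.≟ x ⊕ j) (y≢x ∘ ⊕-cancelʳ j y x)

translate-∁ : ∀ j (p : Subset (suc m)) → translate j (∁ p) ≡ ∁ (translate j p)
translate-∁ j p = vec-ext λ i → begin
  lookup (translate j (∁ p)) i   ≡⟨ lookup-translate j (∁ p) i ⟩
  lookup (∁ p) (i ⊕ j)           ≡⟨ lookup-map (i ⊕ j) not p ⟩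
  not (lookup p (i ⊕ j))         ≡⟨ cong not (lookup-translate j p i) ⟨
  not (lookup (translate j p) i) ≡⟨ lookup-map i not (translate j p) ⟨
  lookup (∁ (translate j p)) i   ∎
  where open ≡-Reasoning

translate-∩ : ∀ j (p q : Subset (suc m)) → translate j (p ∩ q) ≡ translate j p ∩ translate j q
translate-∩ j p q = vec-ext λ i → begin
  lookup (translate j (p ∩ q)) i                       ≡⟨ lookup-translate j (p ∩ q) i ⟩
  lookup (p ∩ q) (i ⊕ j)                               ≡⟨ lookup-zipWith _∧_ (i ⊕ j) p q ⟩
  lookup p (i ⊕ j) ∧ lookup q (i ⊕ j)                  ≡⟨ cong₂ _∧_ (lookup-translate j p i) (lookup-translate j q i) ⟨
  lookup (translate j p) i ∧ lookup (translate j q) i  ≡⟨ lookup-zipWith _∧_ i (translate j p) (translate j q) ⟨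
  lookup (translate j p ∩ translate j q) i             ∎
  where open ≡-Reasoning

translate-- : ∀ j (p : Subset (suc m)) x → translate j (p - (x ⊕ j)) ≡ translate j p - x
translate-- j p x = vec-ext λ i → begin
  lookup (translate j (p - (x ⊕ j))) i                                        ≡⟨ lookup-translate j (p - (x ⊕ j)) i ⟩
  lookup (p - (x ⊕ j)) (i ⊕ j)                                                ≡⟨ lookup-- p (x ⊕ j) (i ⊕ j) ⟩
  (if does (i ⊕ j Fin.≟ x ⊕ j) then outside else lookup p (i ⊕ j))            ≡⟨ cong₂ (λ b s → if b then outside else s) (does-≟-⊕ x i j) (sym (lookup-translate j p i)) ⟩
  (if does (i Fin.≟ x) then outside else lookup (translate j p) i)            ≡⟨ lookup-- (translate j p) x i ⟨
  lookup (translate j p - x) i                                                ∎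
  where open ≡-Reasoning

translate-interval : ∀ j (y x : Fin (suc m)) → translate j [ y ⊕ j , x ⊕ j ⟩ ≡ [ y , x ⟩
translate-interval {m} j y x = tabulate-cong {n = suc m} λ i → trans
  (lookup∘tabulate (λ i → toℕ (i ⊖ (y ⊕ j)) <ᵇ toℕ ((x ⊕ j) ⊖ (y ⊕ j))) (i ⊕ j))
  (cong₂ (λ a b → toℕ a <ᵇ toℕ b) (⊖-⊕ i y j) (⊖-⊕ x y j))

∣interval∩∣ : ∀ j (p : Subset (suc m)) y x → ∣ [ y ⊕ j , x ⊕ j ⟩ ∩ p ∣ ≡ ∣ [ y , x ⟩ ∩ translate j p ∣
∣interval∩∣ j p y x = trans (sym (∣translate∣ j ([ y ⊕ j , x ⊕ j ⟩ ∩ p)))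
  (cong ∣_∣ (trans (translate-∩ j [ y ⊕ j , x ⊕ j ⟩ p) (cong (_∩ translate j p) (translate-interval j y x))))

-- Membership, intervals and intersections all commute with translation, which preserves
-- cardinality. This allows moving the entry in question to position 0.
lexicalColour-translate : ∀ j (S : Subset (suc m)) x → lexicalColour (translate j S) x ≡ lexicalColour S (x ⊕ j)
lexicalColour-translate j S x = sym (trans (sym (∣translate∣ j (tabulate (counted S (x ⊕ j))))) (cong ∣_∣ (tabulate-cong λ y → begin
  lookup (tabulate (counted S (x ⊕ j))) (y ⊕ j) ≡⟨ lookup∘tabulate (counted S (x ⊕ j)) (y ⊕ j) ⟩
  counted S (x ⊕ j) (y ⊕ j)                     ≡⟨ cong₂ _∧_ (member y) (cong₂ _<ᵇ_ (∣interval∩∣ j S y x) (trans (∣interval∩∣ j (∁ S) y x) (cong (λ p → ∣ [ y , x ⟩ ∩ p ∣) (translate-∁ j S)))) ⟩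
  counted (translate j S) x y                   ∎)))
  where
  open ≡-Reasoning
  counted : Subset (suc _) → Fin (suc _) → Fin (suc _) → Bool
  counted S x y = does (y ∈? (∁ S - x)) ∧ (∣ [ y , x ⟩ ∩ S ∣ <ᵇ ∣ [ y , x ⟩ ∩ ∁ S ∣)
  member : ∀ y → does ((y ⊕ j) ∈? (∁ S - (x ⊕ j))) ≡ does (y ∈? (∁ (translate j S) - x))
  member y = begin
    does ((y ⊕ j) ∈? (∁ S - (x ⊕ j)))        ≡⟨ does-∈? _ (y ⊕ j) ⟩
    lookup (∁ S - (x ⊕ j)) (y ⊕ j)           ≡⟨ lookup-translate j (∁ S - (x ⊕ j)) y ⟨
    lookup (translate j (∁ S - (x ⊕ j))) y   ≡⟨ cong (λ p → lookup p y) (trans (translate-- j (∁ S) x) (cong (_- x) (translate-∁ j S))) ⟩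
    lookup (∁ (translate j S) - x) y         ≡⟨ does-∈? _ y ⟨
    does (y ∈? (∁ (translate j S) - x))      ∎

label-translate : ∀ j (b : Subset (suc m)) x → label (translate j b) x ≡ label b (x ⊕ j)
label-translate j b x = cong₂ (λ s c → if s then ∗ else colour c) (lookup-translate j b x) (lexicalColour-translate j b x)

-- The interval from `suc y` to 0 runs to the end of the string. If y ≤ i, the sum passes the
-- modulus and leaves i - y, less than m - y; otherwise it stays below the modulus and is at least m
-- - y.
interval-to-zero : (y i : Fin m) → (toℕ (suc i ⊖ suc y) <ᵇ toℕ (zero {m} ⊖ suc y)) ≡ (toℕ y ≤ᵇ toℕ i)
interval-to-zero {m} y i
  rewrite toℕ-mod {m} (suc (toℕ i) + (m ∸ toℕ y)) | toℕ-mod {m} (m ∸ toℕ y) | m<n⇒m%n≡m (s≤s (ℕ.m∸n≤m m (toℕ y)))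
  with toℕ y ℕ.≤? toℕ i
... | yes y≤i = trans (cong (_<ᵇ m ∸ toℕ y) (begin
  (suc (toℕ i) + (m ∸ toℕ y)) % suc m          ≡⟨ cong (λ z → suc z % suc m) shift ⟩
  (suc (toℕ i ∸ toℕ y + m)) % suc m            ≡⟨ cong (_% suc m) (ℕ.+-suc (toℕ i ∸ toℕ y) m) ⟨
  (toℕ i ∸ toℕ y + suc m) % suc m              ≡⟨ [m+n]%n≡m%n (toℕ i ∸ toℕ y) (suc m) ⟩
  (toℕ i ∸ toℕ y) % suc m                      ≡⟨ m<n⇒m%n≡m (s≤s (ℕ.≤-trans (ℕ.m∸n≤m (toℕ i) (toℕ y)) (ℕ.<⇒≤ (Fin.toℕ<n i)))) ⟩
  toℕ i ∸ toℕ y                                ∎))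
  (trans (T⇒true (ℕ.<⇒<ᵇ (ℕ.∸-monoˡ-< (Fin.toℕ<n i) y≤i))) (sym (T⇒true (ℕ.≤⇒≤ᵇ y≤i))))
  where
  open ≡-Reasoning
  shift : toℕ i + (m ∸ toℕ y) ≡ toℕ i ∸ toℕ y + m
  shift = begin
    toℕ i + (m ∸ toℕ y)                           ≡⟨ cong (_+ (m ∸ toℕ y)) (ℕ.m∸n+n≡m y≤i) ⟨
    toℕ i ∸ toℕ y + toℕ y + (m ∸ toℕ y)           ≡⟨ ℕ.+-assoc (toℕ i ∸ toℕ y) _ _ ⟩
    toℕ i ∸ toℕ y + (toℕ y + (m ∸ toℕ y))         ≡⟨ cong (toℕ i ∸ toℕ y +_) (ℕ.m+[n∸m]≡n (ℕ.<⇒≤ (Fin.toℕ<n y))) ⟩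
    toℕ i ∸ toℕ y + m                             ∎
... | no y≰i = trans (cong (_<ᵇ m ∸ toℕ y) (m<n⇒m%n≡m (s≤s (ℕ.≤-trans (ℕ.+-monoˡ-≤ (m ∸ toℕ y) (ℕ.≰⇒> y≰i)) (ℕ.≤-reflexive (ℕ.m+[n∸m]≡n (ℕ.<⇒≤ (Fin.toℕ<n y))))))))
  (trans (≤⇒≯ᵇ (ℕ.m≤n+m (m ∸ toℕ y) (suc (toℕ i)))) (sym (dec-false (toℕ y ℕ.≤? toℕ i) y≰i)))

∣tail∩∣ : ∀ t (r : Subset m) → ∣ tabulate (λ i → t ≤ᵇ toℕ i) ∩ r ∣ ≡ ones (List.drop t (toList r))
∣tail∩∣ zero    []            = refl
∣tail∩∣ (suc t) []            = refl
∣tail∩∣ zero    (outside ∷ r) = ∣tail∩∣ zero r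
∣tail∩∣ zero    (inside ∷ r)  = cong suc (∣tail∩∣ zero r)
∣tail∩∣ (suc t) (s ∷ r)       = trans (cong (λ p → ∣ p ∩ r ∣) (tabulate-cong λ i → lemma t (toℕ i))) (∣tail∩∣ t r)
  where
  lemma : ∀ t i → (t <ᵇ suc i) ≡ (t ≤ᵇ i)
  lemma zero    i = refl
  lemma (suc t) i = refl

∣interval-to-zero∩∣ : (y : Fin m) (s : Side) (r : Subset m) →
                      ∣ [ suc y , zero ⟩ ∩ (s ∷ r) ∣ ≡ ones (List.drop (toℕ y) (toList r))
∣interval-to-zero∩∣ {m} y s r = trans (head (≤⇒≯ᵇ (ℕ.≤-refl {toℕ (zero {m} ⊖ suc y)})) (tabulate (λ i → toℕ (suc i ⊖ suc y) <ᵇ toℕ (zero {m} ⊖ suc y))))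
  (trans (cong (λ p → ∣ p ∩ r ∣) (tabulate-cong (interval-to-zero y))) (∣tail∩∣ (toℕ y) r))
  where
  head : ∀ {b} → b ≡ outside → (q : Subset m) → ∣ (b ∷ q) ∩ (s ∷ r) ∣ ≡ ∣ q ∩ r ∣
  head refl q = refl

ones-drop-not : ∀ t w → ones (List.drop t (List.map not w)) ≡ zeros (List.drop t w)
ones-drop-not t w = trans (cong ones (List.drop-map t w)) (ones-not (List.drop t w))

∣counted∣ : (r : Subset m) → ∣ tabulate (λ y → not (lookup r y) ∧
              (ones (List.drop (toℕ y) (toList r)) <ᵇ zeros (List.drop (toℕ y) (toList r)))) ∣ ≡ rank (toList r)
∣counted∣ []            = refl
∣counted∣ (inside ∷ r)  = ∣counted∣ r
∣counted∣ (outside ∷ r) with ones (toList r) <ᵇ suc (zeros (toList r))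
... | true  = cong suc (∣counted∣ r)
... | false = ∣counted∣ r

-- For an entry at position 0, the interval from y to it is the suffix of `r` starting at y, which
-- is what `rank` inspects.
lexicalColour-zero : ∀ s (r : Subset m) → lexicalColour (s ∷ r) zero ≡ rank (toList r)
lexicalColour-zero {m} s r = trans (cong ∣_∣ (tabulate-cong λ y → cong₂ _∧_ (member y)
  (cong₂ _<ᵇ_ (∣interval-to-zero∩∣ y s r)
    (trans (∣interval-to-zero∩∣ y (not s) (∁ r)) (trans (cong (ones ∘ List.drop (toℕ y)) (toList-map not r)) (ones-drop-not (toℕ y) (toList r)))))))
  (∣counted∣ r)
  where
  open ≡-Reasoning
  member : ∀ y → does (suc y ∈? (∁ (s ∷ r) - zero)) ≡ not (lookup r y)
  member y = trans (does-∈? (∁ (s ∷ r) - zero) (suc y)) (trans (lookup-- (∁ (s ∷ r)) zero (suc y)) (lookup-map y not r))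

translate-lookup : ∀ x (b : Subset (suc m)) {s r} → translate x b ≡ s ∷ r → lookup b x ≡ s
translate-lookup x b {s} {r} eq = trans (cong (lookup b) (sym (⊕-identityˡ x)))
  (trans (sym (lookup-translate x b zero)) (cong (λ p → lookup p zero) eq))

lexicalColour-rank : ∀ x (b : Subset (suc m)) {s r} → translate x b ≡ s ∷ r → lexicalColour b x ≡ rank (toList r)
lexicalColour-rank x b {s} {r} eq = begin
  lexicalColour b x                  ≡⟨ cong (lexicalColour b) (⊕-identityˡ x) ⟨
  lexicalColour b (zero ⊕ x)         ≡⟨ lexicalColour-translate x b zero ⟨
  lexicalColour (translate x b) zero ≡⟨ cong (λ p → lexicalColour p zero) eq ⟩
  lexicalColour (s ∷ r) zero         ≡⟨ lexicalColour-zero s r ⟩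
  rank (toList r)                    ∎
  where open ≡-Reasoning

if-entry : ∀ s r {c} → c ≡ rank r → (if s then ∗ else colour c) ≡ entry s r
if-entry inside  r _  = refl
if-entry outside r eq = cong colour eq

label-entry : ∀ (b : Subset (suc m)) i {x s y} → length x ≡ toℕ i → toList b ≡ x ++ s ∷ y → label b i ≡ entry s (y ++ x)
label-entry b i {x} {s} {y} l eq = go (translate i b) refl (toList-translate i b {x} {s ∷ y} l eq)
  where
  go : ∀ t → translate i b ≡ t → toList t ≡ s ∷ y ++ x → label b i ≡ entry s (y ++ x)
  go (s′ ∷ r) t≡ q with refl ← List.∷-injectiveˡ q =
    trans (cong (λ z → if z then ∗ else colour (lexicalColour b i)) (translate-lookup i b t≡))
          (if-entry s (y ++ x) (trans (lexicalColour-rank i b t≡) (cong rank (List.∷-injectiveʳ q))))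

tabulate-labelsIn : ∀ rest (w : Subset m) (f : Fin m → Label) →
  (∀ i {x s y} → length x ≡ toℕ i → toList w ≡ x ++ s ∷ y → f i ≡ entry s (y ++ rest ++ x)) →
  List.tabulate f ≡ labelsIn rest (toList w)
tabulate-labelsIn rest []      f h = refl
tabulate-labelsIn rest (s ∷ w) f h = cong₂ _∷_
  (trans (h zero {[]} refl refl) (cong (λ z → entry s (toList w ++ z)) (List.++-identityʳ rest)))
  (tabulate-labelsIn (rest ∷ʳ s) w (f ∘ suc) λ i {x} {s′} {y} l eq →
    trans (h (suc i) (cong suc l) (cong (s ∷_) eq))
          (cong (λ z → entry s′ (y ++ z)) (sym (List.++-assoc rest (s ∷ []) x))))

tabulate-label : (b : Subset (suc m)) → List.tabulate (label b) ≡ labelsIn [] (toList b)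
tabulate-label b = tabulate-labelsIn [] b (label b) (label-entry b)

-- The number of 1-entries of r after which the 1s outnumber the 0s, when z 0s
-- and o 1s precede r.
downs : ℕ → ℕ → List Side → ℕ
downs z o []            = 0
downs z o (outside ∷ r) = downs (suc z) o r
downs z o (inside ∷ r)  = 𝟙 (z <ᵇ suc o) + downs z (suc o) r

-- In a balanced string, a surplus of 0s in a suffix is a surplus of 1s in the complementary prefix.
<ᵇ-balance : ∀ z o a b → z + b ≡ o + a → (a <ᵇ b) ≡ (z <ᵇ o)
<ᵇ-balance z o zero    zero    eq = sym (≤⇒≯ᵇ (ℕ.≤-reflexive (sym (trans (sym (ℕ.+-identityʳ z)) (trans eq (ℕ.+-identityʳ o))))))
<ᵇ-balance z o zero    (suc b) eq = sym (T⇒true (ℕ.<⇒<ᵇ (ℕ.≤-trans (s≤s (ℕ.m≤m+n z b))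
  (ℕ.≤-reflexive (trans (sym (ℕ.+-suc z b)) (trans eq (ℕ.+-identityʳ o)))))))
<ᵇ-balance z o (suc a) zero    eq = sym (≤⇒≯ᵇ (ℕ.≤-trans (ℕ.m≤m+n o (suc a)) (ℕ.≤-reflexive (trans (sym eq) (ℕ.+-identityʳ z)))))
<ᵇ-balance z o (suc a) (suc b) eq = <ᵇ-balance z o a b
  (ℕ.suc-injective (trans (sym (ℕ.+-suc z b)) (trans eq (ℕ.+-suc o a))))

<ᵇ-∸ : ∀ z o → 𝟙 (z <ᵇ o) + (o ∸ suc z) ≡ o ∸ z
<ᵇ-∸ z       zero    = sym (ℕ.0∸n≡0 z)
<ᵇ-∸ zero    (suc o) = refl
<ᵇ-∸ (suc z) (suc o) = <ᵇ-∸ z o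

-- A path crosses a level as often upwards as downwards, up to the crossings
-- forced by its ends.
rank-downs : ∀ z o r → z + zeros r ≡ o + ones r → rank r ≡ downs z o r + (o ∸ z)
rank-downs z o []            eq = sym (trans (cong (o ∸_) (trans (sym (ℕ.+-identityʳ z)) (trans eq (ℕ.+-identityʳ o)))) (ℕ.n∸n≡0 o))
rank-downs z o (outside ∷ r) eq = begin
  𝟙 (ones r <ᵇ suc (zeros r)) + rank r                   ≡⟨ cong₂ _+_ (cong 𝟙 (<ᵇ-balance z o (ones r) (suc (zeros r)) eq)) (rank-downs (suc z) o r (trans (sym (ℕ.+-suc z _)) eq)) ⟩
  𝟙 (z <ᵇ o) + (downs (suc z) o r + (o ∸ suc z))         ≡⟨ x∙yz≈y∙xz (𝟙 (z <ᵇ o)) (downs (suc z) o r) _ ⟩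
  downs (suc z) o r + (𝟙 (z <ᵇ o) + (o ∸ suc z))         ≡⟨ cong (downs (suc z) o r +_) (<ᵇ-∸ z o) ⟩
  downs (suc z) o r + (o ∸ z)                            ∎
  where
  open ≡-Reasoning
rank-downs z o (inside ∷ r)  eq = begin
  rank r                                                  ≡⟨ rank-downs z (suc o) r (trans eq (ℕ.+-suc o _)) ⟩
  downs z (suc o) r + (suc o ∸ z)                         ≡⟨ cong (downs z (suc o) r +_) (<ᵇ-∸ z (suc o)) ⟨
  downs z (suc o) r + (𝟙 (z <ᵇ suc o) + (o ∸ z))          ≡⟨ x∙yz≈yx∙z (downs z (suc o) r) (𝟙 (z <ᵇ suc o)) _ ⟩
  𝟙 (z <ᵇ suc o) + downs z (suc o) r + (o ∸ z)            ∎
  where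
  open ≡-Reasoning

-- `t` stands for the complemented reversal of the letters already passed, so its 1s are their 0s;
-- hence the exchanged counts given to `downs`. The 1-entries of `r` become the counted 0-entries.
rank-reverse : ∀ r t → rank (List.map not (List.reverse r) ++ t) ≡ downs (ones t) (zeros t) r + rank t
rank-reverse []      t = refl
rank-reverse (s ∷ r) t = trans
  (cong rank (trans (cong (λ z → List.map not z ++ t) (List.unfold-reverse s r))
             (trans (cong (_++ t) (List.map-++ not (List.reverse r) (s ∷ [])))
                    (List.++-assoc (List.map not (List.reverse r)) _ t))))
  (trans (rank-reverse r (not s ∷ t)) (step s))
  where
  step : ∀ s → downs (ones (not s ∷ t)) (zeros (not s ∷ t)) r + rank (not s ∷ t) ≡ downs (ones t) (zeros t) (s ∷ r) + rank t
  step inside  = x∙yz≈yx∙z (downs (ones t) (suc (zeros t)) r) (𝟙 (ones t <ᵇ suc (zeros t))) _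
  step outside = refl

rank-reverse-balanced : ∀ r → zeros r ≡ ones r → rank (List.map not (List.reverse r)) ≡ rank r
rank-reverse-balanced r bal = trans (cong rank (sym (List.++-identityʳ (List.map not (List.reverse r)))))
  (trans (rank-reverse r []) (sym (rank-downs 0 0 r bal)))

toList-ℵ : (r : Subset m) → toList (ℵ r) ≡ List.map not (List.reverse (toList r))
toList-ℵ r = trans (toList-map not (reverse r)) (cong (List.map not) (toList-reverse r))

lexicalColour-ℵ : ∀ x (b : Subset (suc m)) {s r} → translate x b ≡ s ∷ r → zeros (toList r) ≡ ones (toList r) →
                  lexicalColour (ℵ b) (opposite x) ≡ rank (toList r)
lexicalColour-ℵ {m} x b {s} {r} eq bal = go (translate (opposite x) (ℵ b)) refl (begin
  toList (translate (opposite x) (ℵ b))                     ≡⟨ cong (λ j → toList (translate j (ℵ b))) opposite-x ⟩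
  -- Shifting by -x turns `ℵ b` into `ℵ (s ∷ r)`, whose last letter is the complement of `s`;
  -- shifting by the last index then brings that letter to the front.
  toList (translate (fromℕ m ⊕ (zero ⊖ x)) (ℵ b))           ≡⟨ cong toList (translate-translate (fromℕ m) (zero ⊖ x) (ℵ b)) ⟨
  toList (translate (fromℕ m) (translate (zero ⊖ x) (ℵ b))) ≡⟨ cong (toList ∘ translate (fromℕ m)) (translate-ℵ x b eq) ⟩
  toList (translate (fromℕ m) (ℵ (s ∷ r)))                  ≡⟨ toList-translate (fromℕ m) (ℵ (s ∷ r)) {r̄} {not s ∷ []} len snoc ⟩
  not s ∷ r̄                                                ∎)
  where
  open ≡-Reasoning
  r̄ = List.map not (List.reverse (toList r))
  opposite-x : opposite x ≡ fromℕ m ⊕ (zero ⊖ x)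
  opposite-x = ⊕-cancelʳ x _ _ (trans (opposite-⊕ x)
    (sym (trans (⊕-assoc (fromℕ m) _ x) (trans (cong (fromℕ m ⊕_) (⊕-⊖ zero x)) (⊕-identityʳ _)))))
  len : length r̄ ≡ toℕ (fromℕ m)
  len = trans (List.length-map not (List.reverse (toList r))) (trans (List.length-reverse (toList r)) (trans (length-toList r) (sym (Fin.toℕ-fromℕ m))))
  snoc : toList (ℵ (s ∷ r)) ≡ r̄ ++ not s ∷ []
  snoc = trans (toList-ℵ (s ∷ r)) (trans (cong (List.map not) (List.unfold-reverse s (toList r))) (List.map-++ not (List.reverse (toList r)) (s ∷ [])))
  go : ∀ t → translate (opposite x) (ℵ b) ≡ t → toList t ≡ not s ∷ r̄ → lexicalColour (ℵ b) (opposite x) ≡ rank (toList r)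
  go (s′ ∷ r′) t≡ q = trans (lexicalColour-rank (opposite x) (ℵ b) t≡)
    (trans (cong rank (List.∷-injectiveʳ q)) (rank-reverse-balanced (toList r) bal))

occ-none : ∀ ℓ (f : Fin m → Label) → occ ℓ (List.tabulate f) ≡ 0 → ∀ i → f i ≢ ℓ
occ-none {suc m} ℓ f eq i f≡ with f zero ≟ ℓ in q
... | no f0≢ with i
...   | zero  = f0≢ f≡
...   | suc i = occ-none ℓ (f ∘ suc) eq i f≡

occ-unique : ∀ ℓ (f : Fin m → Label) → occ ℓ (List.tabulate f) ≡ 1 → ∃! _≡_ (λ i → f i ≡ ℓ)
occ-unique {suc m} ℓ f eq with f zero ≟ ℓ
... | yes f0≡ = zero , f0≡ , λ { {zero} _ → refl ; {suc i} fi≡ → contradiction fi≡ (occ-none ℓ (f ∘ suc) (ℕ.suc-injective eq) i) }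
... | no f0≢ with i , fi≡ , unique ← occ-unique ℓ (f ∘ suc) eq =
  suc i , fi≡ , λ { {zero} f0≡ → contradiction f0≡ f0≢ ; {suc j} fj≡ → cong suc (unique fj≡) }

-- The graphs

∣[]≔inside∣ : (b : Subset m) (x : Fin m) → lookup b x ≡ outside → ∣ b [ x ]≔ inside ∣ ≡ suc ∣ b ∣
∣[]≔inside∣ (outside ∷ b) zero    _ = refl
∣[]≔inside∣ (outside ∷ b) (suc x) e = ∣[]≔inside∣ b x e
∣[]≔inside∣ (inside ∷ b)  (suc x) e = cong suc (∣[]≔inside∣ b x e)

update-eq : (u w : Vec A m) (x : Fin m) → (∀ i → i ≢ x → lookup u i ≡ lookup w i) → w ≡ u [ x ]≔ lookup w x
update-eq u w x agree = vec-ext go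
  where
  go : ∀ i → lookup w i ≡ lookup (u [ x ]≔ lookup w x) i
  go i with i Fin.≟ x
  ... | yes refl = sym (lookup∘update x u (lookup w x))
  ... | no i≢x   = sym (trans (lookup∘update′ i≢x u (lookup w x)) (agree i i≢x))

translate-update : ∀ j (u : Vec A (suc m)) x s → translate j (u [ x ⊕ j ]≔ s) ≡ translate j u [ x ]≔ s
translate-update j u x s = vec-ext go
  where
  go : ∀ i → lookup (translate j (u [ x ⊕ j ]≔ s)) i ≡ lookup (translate j u [ x ]≔ s) i
  go i with i Fin.≟ x
  ... | yes refl = trans (lookup-translate j (u [ x ⊕ j ]≔ s) i)
    (trans (lookup∘update (i ⊕ j) u s) (sym (lookup∘update i (translate j u) s)))
  ... | no i≢x   = trans (lookup-translate j (u [ x ⊕ j ]≔ s) i)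
    (trans (lookup∘update′ (i≢x ∘ ⊕-cancelʳ j i x) u s)
    (sym (trans (lookup∘update′ i≢x (translate j u) s) (lookup-translate j u i))))

⊖-involutive : (j : Fin (suc m)) → zero ⊖ (zero ⊖ j) ≡ j
⊖-involutive j = ⊕-cancelʳ (zero ⊖ j) _ _ (trans (⊕-⊖ zero (zero ⊖ j)) (sym (trans (⊕-comm j _) (⊕-⊖ zero j))))

translate-ℵ-flip : ∀ j (u w : Subset (suc m)) → translate (zero ⊖ j) u ≡ ℵ w → translate j (ℵ u) ≡ w
translate-ℵ-flip j u w eq = begin
  translate j (ℵ u)                   ≡⟨ cong (λ l → translate l (ℵ u)) (⊖-involutive j) ⟨
  translate (zero ⊖ (zero ⊖ j)) (ℵ u) ≡⟨ translate-ℵ (zero ⊖ j) u eq ⟩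
  ℵ (ℵ w)                             ≡⟨ ℵ-involutive w ⟩
  w                                   ∎
  where open ≡-Reasoning

adjacent-update : (u w : Subset m) → ((x , _) : Adjacent u w) → ∣ w ∣ ≡ suc ∣ u ∣ →
                  lookup u x ≡ outside × w ≡ u [ x ]≔ inside
adjacent-update u w (x , differ , unique) weight with lookup u x in ux | lookup w x in wx
... | outside | outside = contradiction refl differ
... | inside  | inside  = contradiction refl differ
... | outside | inside  = refl , trans (update-eq u w x agree) (cong (u [ x ]≔_) wx)
  where
  agree : ∀ i → i ≢ x → lookup u i ≡ lookup w i
  agree i i≢x with lookup u i ≟ᵇ lookup w i
  ... | yes eq = eq
  ... | no ne  = contradiction (sym (unique ne)) i≢x
... | inside  | outside = contradiction
  (trans weight (cong suc (trans (cong ∣_∣ (trans (update-eq w u x agree) (cong (w [ x ]≔_) ux))) (∣[]≔inside∣ w x wx))))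
  (ℕ.<⇒≢ (s≤s (ℕ.n≤1+n ∣ w ∣)))
  where
  agree : ∀ i → i ≢ x → lookup w i ≡ lookup u i
  agree i i≢x with lookup u i ≟ᵇ lookup w i
  ... | yes eq = sym eq
  ... | no ne  = contradiction (sym (unique ne)) i≢x

label-outside : (b : Subset (suc m)) (i : Fin (suc m)) → lookup b i ≡ outside → label b i ≡ colour (lexicalColour b i)
label-outside b i eq = cong (λ s → if s then ∗ else colour (lexicalColour b i)) eq

label-colour : (b : Subset (suc m)) (i : Fin (suc m)) → ∀ {c} → label b i ≡ colour c → lookup b i ≡ outside × lexicalColour b i ≡ c
label-colour b i eq with lookup b i
label-colour b i eq | outside = refl , colour-injective eq

-- The graphs are indexed by `k` and germs by `k ∸ 1`. Matching `k` as a successor makes the latter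
-- reduce, here and in the next two lemmas.
germ-of-word : ∀ {k} → 0 < k → ∀ w → zeros w ≡ suc (ones w) → ones w ≡ k →
               Σ (Vec ℕ (k ∸ 1)) λ α → IsGerm α × labelsIn [] w ⟳ wrap (labels α)
germ-of-word {suc m} _ = labelsIn-germ

F≡wrap : ∀ {k} → 0 < k → (α : Vec ℕ (k ∸ 1)) → IsGerm α → F k α ≡ wrap (labels α)
F≡wrap {suc m} _ = F-labels

occ-F : ∀ {k} → 0 < k → (α : Vec ℕ (k ∸ 1)) → ∀ c → occ (colour c) (wrap (labels α)) ≡ 𝟙 (c <ᵇ suc k)
occ-F {suc m} _ α = occ-wrap (labels α) (occ-labels α)

module Graphs (k : ℕ) (0<k : 0 < k) where

  ones-L : ((b , _) : L k k) → ones (toList b) ≡ k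
  ones-L (b , p) = trans (sym (∣∣-ones b)) p

  zeros-L : ((b , _) : L k k) → zeros (toList b) ≡ suc (ones (toList b))
  zeros-L v@(b , _) = ℕ.+-cancelʳ-≡ k (zeros (toList b)) _ (begin
    zeros (toList b) + k               ≡⟨ cong (zeros (toList b) +_) (ones-L v) ⟨
    zeros (toList b) + ones (toList b) ≡⟨ trans (zeros+ones (toList b)) (length-toList b) ⟩
    suc (k + (k + 0))                  ≡⟨ cong (λ z → suc (k + z)) (ℕ.+-identityʳ k) ⟩
    suc (k + k)                        ≡⟨ cong (λ z → suc (z + k)) (ones-L v) ⟨
    suc (ones (toList b)) + k          ∎)
    where open ≡-Reasoning

  germ : ((b , _) : L k k) → Σ (Vec ℕ (k ∸ 1)) λ α → IsGerm α × List.tabulate (label b) ⟳ wrap (labels α)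
  germ v@(b , _) with α , g , t ← germ-of-word 0<k (toList b) (zeros-L v) (ones-L v) =
    α , g , subst (_⟳ wrap (labels α)) (sym (tabulate-label b)) t

  occ-label : ((b , _) : L k k) → ∀ c → occ (colour c) (List.tabulate (label b)) ≡ 𝟙 (c <ᵇ suc k)
  occ-label v c with α , _ , t ← germ v = trans (⟳-occ (colour c) t) (occ-F 0<k α c)

  unique-label : ((b , _) : L k k) → ∀ {c} → c ≤ k → ∃! _≡_ (λ i → label b i ≡ colour c)
  unique-label v@(b , _) {c} c≤k = occ-unique (colour c) (label b) (occ-once (List.tabulate (label b)) c (occ-label v c) c≤k)

  label-≤ : ((b , _) : L k k) → ∀ i {c} → label b i ≡ colour c → c ≤ k
  label-≤ v@(b , _) i {c} eq with c ℕ.≤? k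
  ... | yes c≤k = c≤k
  ... | no c≰k  = contradiction eq
    (occ-none (colour c) (label b) (trans (occ-label v c) (cong 𝟙 (≤⇒≯ᵇ (ℕ.≰⇒> c≰k)))) i)

  δ-cong : (v w : L k k) → proj₁ v ~ proj₁ w → δ k v ≡ δ k w
  δ-cong v@(b , _) w@(b′ , _) (j , refl) = rotateTo-⟳ (colour 0)
    (subst₂ _⟳_ (sym (tabulate-label b)) (sym (tabulate-label b′)) (labelsIn-cong (translate-⟳ j b)))
    (occ-once {k} (List.tabulate (label b)) 0 (occ-label v 0) z≤n)

  germ-δ : (v : L k k) → ∃! _≡_ (λ α → IsGerm α × ⟨ F k α ⟩ ≡ δ k v)
  germ-δ v@(b , _) with α , g , t ← germ v = α , (g , eq) , λ {α′} (g′ , eq′) →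
    labels-injective α α′ g g′ (wrap-injective (trans (sym (⟨F⟩ α g)) (trans (trans eq (sym eq′)) (⟨F⟩ α′ g′))))
    where
    ⟨F⟩ : ∀ α → IsGerm α → ⟨ F k α ⟩ ≡ wrap (labels α)
    ⟨F⟩ α g = trans (cong ⟨_⟩ (F≡wrap 0<k α g)) (rotateTo-here (colour 0) _)
    eq : ⟨ F k α ⟩ ≡ δ k v
    eq = trans (cong ⟨_⟩ (F≡wrap 0<k α g))
      (rotateTo-⟳ (colour 0) (⟳-sym t) (occ-wrap-0 (labels α)))

  open Edge

  position-outside : (e : Edge k) → lookup (lo e) (position e) ≡ outside
  position-outside e = proj₁ (adjacent-update (lo e) (hi e) (adjacent e) (trans (proj₂ (upper e)) (cong suc (sym (proj₂ (lower e))))))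

  hi-update : (e : Edge k) → hi e ≡ lo e [ position e ]≔ inside
  hi-update e = proj₂ (adjacent-update (lo e) (hi e) (adjacent e) (trans (proj₂ (upper e)) (cong suc (sym (proj₂ (lower e))))))

  label-position : (e : Edge k) → label (lo e) (position e) ≡ colour (lexical k e)
  label-position e = label-outside (lo e) (position e) (position-outside e)

  lexical-≤ : (e : Edge k) → lexical k e ≤ k
  lexical-≤ e = label-≤ (lower e) (position e) (label-position e)

  lexical-translate : ∀ j (e f : Edge k) → translate j (lo e) ≡ lo f → translate j (hi e) ≡ hi f → lexical k e ≡ lexical k f
  lexical-translate j e f p q = begin
    -- The ends of `e` differ at `position f ⊕ j`, and they differ at only one position.
    lexicalColour (lo e) (position e)                   ≡⟨ cong (lexicalColour (lo e)) (proj₂ (proj₂ (adjacent e)) differ) ⟩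
    lexicalColour (lo e) (position f ⊕ j)               ≡⟨ lexicalColour-translate j (lo e) (position f) ⟨
    lexicalColour (translate j (lo e)) (position f)     ≡⟨ cong (λ b → lexicalColour b (position f)) p ⟩
    lexicalColour (lo f) (position f)                   ∎
    where
    open ≡-Reasoning
    at : ∀ (u : Subset (n k)) {w} → translate j u ≡ w → lookup w (position f) ≡ lookup u (position f ⊕ j)
    at u refl = lookup-translate j u (position f)
    differ : lookup (lo e) (position f ⊕ j) ≢ lookup (hi e) (position f ⊕ j)
    differ eq = proj₁ (proj₂ (adjacent f)) (trans (at (lo e) p) (trans eq (sym (at (hi e) q))))

  lexical-cong : ∀ {e f} → Multigraph.E._≈_ (M/π k) e f → lexical k e ≡ lexical k f
  lexical-cong {e} {f} (j , p , q) = lexical-translate j e f p q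

  lexical-ℵ : ∀ e → lexical k (ℵᴱ k e) ≡ lexical k e
  lexical-ℵ e = go (translate x (lo e)) refl
    where
    x = position e
    go : ∀ t → translate x (lo e) ≡ t → lexical k (ℵᴱ k e) ≡ lexical k e
    go (s ∷ r) eq = trans (lexicalColour-ℵ x (hi e) hi≡ bal) (sym (lexicalColour-rank x (lo e) eq))
      where
      hi≡ : translate x (hi e) ≡ inside ∷ r
      hi≡ = begin
        translate x (hi e)                            ≡⟨ cong (translate x) (hi-update e) ⟩
        translate x (lo e [ x ]≔ inside)              ≡⟨ cong (λ z → translate x (lo e [ z ]≔ inside)) (⊕-identityˡ x) ⟨
        translate x (lo e [ zero ⊕ x ]≔ inside)       ≡⟨ translate-update x (lo e) zero inside ⟩
        translate x (lo e) [ zero ]≔ inside           ≡⟨ cong (_[ zero ]≔ inside) eq ⟩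
        inside ∷ r                                    ∎
        where open ≡-Reasoning
      bal : zeros (toList r) ≡ ones (toList r)
      -- The lower string has k + 1 0s and k 1s; without the 0 that the edge flips, k of each
      -- remain.
      bal with refl ← trans (sym (position-outside e)) (translate-lookup x (lo e) eq) =
        ℕ.suc-injective (zeros-L (outside ∷ r , trans (cong ∣_∣ (sym eq)) (trans (∣translate∣ x (lo e)) (proj₂ (lower e)))))

  -- `near` and `far` allow either level as the starting side. In `unique` the translation `j` that
  -- matches the near ends must also match the far ends: this is equality of edges in `M/π`, and
  -- `j = zero` gives equality in `M`.
  record UniqueEdge {w : ℕ} (near far : Edge k → Subset (n k)) (v : L k w) (c : ℕ) : Set where
    constructor uniqueEdge
    field
      e       : Edge k
      near≡   : near e ≡ proj₁ v
      colour≡ : lexical k e ≡ c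
      unique  : ∀ j f → translate j (proj₁ v) ≡ near f → lexical k f ≡ c → translate j (far e) ≡ far f

    ~-near : proj₁ v ~ near e
    ~-near = zero , trans (translate-zero (proj₁ v)) (sym near≡)

    translate-near : ∀ j {b} → translate j (proj₁ v) ≡ b → translate j (near e) ≡ b
    translate-near j t = trans (cong (translate j) near≡) t

    untranslated : ∀ f → proj₁ v ≡ near f → lexical k f ≡ c → near e ≡ near f × far e ≡ far f
    untranslated f t lex = trans near≡ t ,
      trans (sym (translate-zero (far e))) (unique zero f (trans (translate-zero (proj₁ v)) t) lex)

  fromLower : (v : L k k) → ∀ {c} → c ≤ k → UniqueEdge lo hi v c
  fromLower v@(b , p) {c} c≤k = raising (unique-label v c≤k)
    where
    raising : ∃! _≡_ (λ i → label b i ≡ colour c) → UniqueEdge lo hi v c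
    raising (x , label≡ , unique) =
      -- The edge flips the only entry with label `c`; a competing edge, translated back, flips an
      -- entry with the same label.
      uniqueEdge (edge v (b [ x ]≔ inside , trans (∣[]≔inside∣ b x out) (cong suc p)) (x , differs , differ))
                 refl (proj₂ (label-colour b x label≡)) determined
      where
      out : lookup b x ≡ outside
      out = proj₁ (label-colour b x label≡)
      differs : lookup b x ≢ lookup (b [ x ]≔ inside) x
      differs eq = contradiction (trans (sym out) (trans eq (lookup∘update x b inside))) λ ()
      differ : ∀ {i} → lookup b i ≢ lookup (b [ x ]≔ inside) i → x ≡ i
      differ {i} ne with i Fin.≟ x
      ... | yes i≡x = sym i≡x
      ... | no i≢x  = contradiction (sym (lookup∘update′ i≢x b inside)) ne
      open ≡-Reasoning
      label≡′ : ∀ j f → translate j b ≡ lo f → lexical k f ≡ c → label b (position f ⊕ j) ≡ colour c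
      label≡′ j f t lex = begin
        label b (position f ⊕ j)                        ≡⟨ label-translate j b (position f) ⟨
        label (translate j b) (position f)              ≡⟨ cong (λ u → label u (position f)) t ⟩
        label (lo f) (position f)                       ≡⟨ label-position f ⟩
        colour (lexical k f)                            ≡⟨ cong colour lex ⟩
        colour c                                        ∎
      determined : ∀ j f → translate j b ≡ lo f → lexical k f ≡ c → translate j (b [ x ]≔ inside) ≡ hi f
      determined j f t lex = begin
        translate j (b [ x ]≔ inside)                   ≡⟨ cong (λ y → translate j (b [ y ]≔ inside)) (unique (label≡′ j f t lex)) ⟩
        translate j (b [ position f ⊕ j ]≔ inside)      ≡⟨ translate-update j b (position f) inside ⟩
        translate j b [ position f ]≔ inside            ≡⟨ cong (_[ position f ]≔ inside) t ⟩
        lo f [ position f ]≔ inside                     ≡⟨ hi-update f ⟨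
        hi f                                            ∎

  -- `ℵ` exchanges the levels, keeps the colours and reverses the direction of translation, whence
  -- `zero ⊖ j`.
  fromUpper : (v : L k (suc k)) → ∀ {c} → c ≤ k → UniqueEdge hi lo v c
  fromUpper v@(b , _) c≤k = uniqueEdge (ℵᴱ k e) (trans (cong ℵ near≡) (ℵ-involutive b)) (trans (lexical-ℵ e) colour≡)
    λ j f t lex → translate-ℵ-flip j (hi e) (lo f) (unique (zero ⊖ j) (ℵᴱ k f) (translate-ℵ j b t) (trans (lexical-ℵ f) lex))
    where open UniqueEdge (fromLower (ℵ-upper k v) c≤k)

  levels-disjoint : ∀ (b : Subset (n k)) {b′} j → translate j b ≡ b′ → ∣ b ∣ ≡ k → ∣ b′ ∣ ≢ suc k
  levels-disjoint b j refl p q = contradiction (trans (sym p) (trans (sym (∣translate∣ j b)) q)) (ℕ.<⇒≢ ℕ.≤-refl)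

  -- The three factorizations

  factorization-M/π : OneFactorization (M/π k) k (lexical k)
  factorization-M/π = record
    { colour-cong = λ {e} {f} → lexical-cong {e} {f}
    ; colour-≤    = lexical-≤
    ; exactly-one = exactly-one
    }
    where
    exactly-one : ∀ v c → c ≤ k → ∃! (Multigraph.E._≈_ (M/π k)) (λ e → Multigraph.Incident (M/π k) v e × lexical k e ≡ c)
    exactly-one (b , inj₁ p) c c≤k = e , (inj₁ ~-near , colour≡) , λ
      { {f} (inj₁ (j , t) , lex) → j , translate-near j t , unique j f t lex
      ; {f} (inj₂ (j , t) , _)   → contradiction (proj₂ (upper f)) (levels-disjoint b j t p) }
      where open UniqueEdge (fromLower (b , p) c≤k)
    exactly-one (b , inj₂ p) c c≤k = e , (inj₂ ~-near , colour≡) , λ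
      { {f} (inj₁ (j , t) , _)   → contradiction p (levels-disjoint (lo f) (zero ⊖ j) (translate-inverse j b t) (proj₂ (lower f)))
      ; {f} (inj₂ (j , t) , lex) → j , unique j f t lex , translate-near j t }
      where open UniqueEdge (fromUpper (b , p) c≤k)

  factorization-M : OneFactorization (M k) k (lifted k)
  factorization-M = record
    { colour-cong = λ {e} {f} (p , q) → lexical-translate zero e f (trans (translate-zero (lo e)) p) (trans (translate-zero (hi e)) q)
    ; colour-≤    = lexical-≤
    ; exactly-one = exactly-one
    }
    where
    exactly-one : ∀ v c → c ≤ k → ∃! (Multigraph.E._≈_ (M k)) (λ e → Multigraph.Incident (M k) v e × lexical k e ≡ c)
    exactly-one (b , inj₁ p) c c≤k = e , (inj₁ (sym near≡) , colour≡) , λ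
      { {f} (inj₁ t , lex) → untranslated f t lex
      ; {f} (inj₂ t , _)   → contradiction (proj₂ (upper f)) (levels-disjoint b zero (trans (translate-zero b) t) p) }
      where open UniqueEdge (fromLower (b , p) c≤k)
    exactly-one (b , inj₂ p) c c≤k = e , (inj₂ (sym near≡) , colour≡) , λ
      { {f} (inj₁ t , _)   → contradiction p (levels-disjoint b zero (translate-zero b) (trans (cong ∣_∣ t) (proj₂ (lower f))))
      ; {f} (inj₂ t , lex) → swap (untranslated f t lex) }
      where open UniqueEdge (fromUpper (b , p) c≤k)

  -- An edge of `R` carries a proof that it is skew or horizontal, so constructing one requires a
  -- decision; a search through the finitely many translations provides it.
  horizontal? : ∀ e → Dec (Horizontal k e)
  horizontal? e = Fin.any? (λ j → ≡-dec _≟ᵇ_ (translate j (ℵ (lo e))) (hi e))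

  ~-sym : (u : Subset (n k)) {w : Subset (n k)} → u ~ w → w ~ u
  ~-sym u (j , p) = zero ⊖ j , translate-inverse j u p

  ~-trans : (u : Subset (n k)) {v w : Subset (n k)} → u ~ v → v ~ w → u ~ w
  ~-trans u (j , p) (l , q) = l ⊕ j , translate-compose j l u p q

  ℵ-cong : (u : Subset (n k)) {w : Subset (n k)} → u ~ w → ℵ u ~ ℵ w
  ℵ-cong u (j , p) = zero ⊖ j , translate-ℵ j u p

  ℵ-swap : (u : Subset (n k)) {w : Subset (n k)} → ℵ u ~ w → u ~ ℵ w
  ℵ-swap u (j , p) = zero ⊖ j , trans (cong (translate (zero ⊖ j)) (sym (ℵ-involutive u))) (translate-ℵ j (ℵ u) p)

  horizontal-cong : ∀ {e f} → Multigraph.E._≈_ (M/π k) e f → Horizontal k e → Horizontal k f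
  horizontal-cong {e} {f} (j , p , q) h =
    ~-trans (ℵ (lo f)) (~-sym (ℵ (lo e)) (ℵ-cong (lo e) (j , p))) (~-trans (ℵ (lo e)) h (j , q))

  horizontal-ℵ : ∀ e → Horizontal k (ℵᴱ k e) → Horizontal k e
  horizontal-ℵ e h = ~-sym (hi e) (subst (_~ ℵ (lo e)) (ℵ-involutive (hi e)) h)

  -- The candidate at a vertex is the edge of colour `c` at its lower member, as a link or a loop. A
  -- link that meets the vertex through its upper end is replaced by its image under `ℵ`, which has
  -- the same colour and meets the lower member. Links and loops cannot compete, since horizontality
  -- is invariant under translation and `ℵ`.
  factorization-R : OneFactorization (R k) k (collapsed k)
  factorization-R = record
    { colour-cong = λ {e} {f} → colour-cong {e} {f}
    ; colour-≤    = λ e → lexical-≤ (source k e)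
    ; exactly-one = exactly-one
    }
    where
    open Multigraph (R k) using (Incident; module E)

    colour-cong : ∀ {e f} → e E.≈ f → collapsed k e ≡ collapsed k f
    colour-cong {link e _} {link f _} (inj₁ p) = lexical-cong {e} {f} p
    colour-cong {link e _} {link f _} (inj₂ p) = trans (lexical-cong {e} {ℵᴱ k f} p) (lexical-ℵ f)
    colour-cong {loop e _} {loop f _} p        = lexical-cong {e} {f} p

    exactly-one : ∀ v c → c ≤ k → ∃! E._≈_ (λ e → Incident v e × collapsed k e ≡ c)
    exactly-one v c c≤k = by-kind (horizontal? e)
      where
      open UniqueEdge (fromLower v c≤k)

      same : ∀ f → proj₁ v ~ lo f → lexical k f ≡ c → Multigraph.E._≈_ (M/π k) e f
      same f (j , t) lex = j , translate-near j t , unique j f t lex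

      same-ℵ : ∀ f → proj₁ v ~ ℵ (hi f) → lexical k f ≡ c → Multigraph.E._≈_ (M/π k) e (ℵᴱ k f)
      same-ℵ f t lex = same (ℵᴱ k f) t (trans (lexical-ℵ f) lex)

      -- The two ends of a loop are the same vertex of `R`, so incidence through the second end
      -- yields incidence through the first.
      same-loop : ∀ f → Horizontal k f → proj₁ v ~ ℵ (hi f) → lexical k f ≡ c → Multigraph.E._≈_ (M/π k) e f
      same-loop f h t = same f (~-trans (proj₁ v) t (~-sym (lo f) (ℵ-swap (lo f) h)))

      by-kind : Dec (Horizontal k e) → ∃! E._≈_ (λ f → Incident v f × collapsed k f ≡ c)
      by-kind (no skew) = link e skew , (inj₁ ~-near , colour≡) , λ
        { {link f _} (inj₁ t , lex) → inj₁ (same f t lex)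
        ; {link f _} (inj₂ t , lex) → inj₂ (same-ℵ f t lex)
        ; {loop f h} (inj₁ t , lex) → skew (horizontal-cong {f} {e} (C.sym k {e} {f} (same f t lex)) h)
        ; {loop f h} (inj₂ t , lex) → skew (horizontal-cong {f} {e} (C.sym k {e} {f} (same-loop f h t lex)) h) }
      by-kind (yes h) = loop e h , (inj₁ ~-near , colour≡) , λ
        { {link f skew} (inj₁ t , lex) → skew (horizontal-cong {e} {f} (same f t lex) h)
        ; {link f skew} (inj₂ t , lex) → skew (horizontal-ℵ f (horizontal-cong {e} {ℵᴱ k f} (same-ℵ f t lex) h))
        ; {loop f _} (inj₁ t , lex) → same f t lex
        ; {loop f h′} (inj₂ t , lex) → same-loop f h′ t lex }

theorem8 : (k : ℕ) → 1 < k →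
    OneFactorization (M/π k) k (lexical k) ×
    OneFactorization (M k) k (lifted k) ×
    OneFactorization (R k) k (collapsed k) ×
    ((v : Multigraph.V.Carrier (R k)) → ∃! _≡_ (λ i → label (proj₁ v) i ≡ colour 0)) ×
    ((v w : Multigraph.V.Carrier (R k)) → Multigraph.V._≈_ (R k) v w → δ k v ≡ δ k w) ×
    ((v : Multigraph.V.Carrier (R k)) → ∃! _≡_ (λ α → IsGerm α × ⟨ F k α ⟩ ≡ δ k v))
theorem8 k 1<k = factorization-M/π , factorization-M , factorization-R , (λ v → unique-label v z≤n) , δ-cong , germ-δ
  where open Graphs k (ℕ.<⇒≤ 1<k)
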